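{- Let $n\ge 1$ and let $f:\{\pm 1\}^n\to[-1,1]$ be a function of degree $d$. Let $\ell$ be an integer with $0\le \ell\le d$. Then $$\|f_\ell\|_\infty \le \begin{cases} |C(d,\ell)| & \text{if } d\equiv \ell \pmod 2,\\ |C(d-1,\ell)| & \text{otherwise.}\end{cases}$$
   Context: Every $f:\{\pm1\}^n\to\mathbb{R}$ is uniquely written as $f(x)=\sum_{S\subseteq[n]}\hat f(S)\chi_S(x)$ with $\chi_S(x)=\prod_{j\in S}x_j$ and $\hat f(S)\in\mathbb{R}$ (the Fourier coefficients). The degree of $f$ is its degree as this multilinear polynomial. The $\ell$-th homogeneous part is $f_\ell(x)=\sum_{S\subseteq[n],\,|S|=\ell}\hat f(S)\chi_S(x)$, and $\|f_\ell\|_\infty=\max_{x\in\{\pm1\}^n}|f_\ell(x)|$. $T_d(z)$ is the Chebyshev polynomial of degree $d$, the unique polynomial of degree $d$ with $T_d(\cos\theta)=\cos(d\theta)$, and $C(d,\ell)$ is the coefficient of $z^\ell$ in $T_d(z)$. -}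

module Defs where

open import Algebra.Bundles using (CommutativeRing)
open import Algebra.Structures using (IsCommutativeRing)
open import Data.Bool.Base using (if_then_else_)
open import Data.Fin.Subset using (Subset; inside; outside; ∣_∣)
open import Data.List.Base using (List; []; _∷_)
open import Data.Nat.Base as ℕ using (ℕ; zero; suc)
import Data.Nat.Properties as ℕ
open import Data.Product.Base using (Σ; ∃; ∃-syntax; _×_; _,_; proj₁; proj₂)
open import Data.Rational.Base as ℚ using (ℚ; 0ℚ; 1ℚ; ½)
import Data.Rational.Properties as ℚ
open import Data.Rational.Solver using (module +-*-Solver)
open import Data.Sign.Base using (Sign) renaming (+ to plus; - to minus)
open import Data.Sum.Base using (_⊎_; inj₁; inj₂)
open import Data.Vec.Base using (Vec; []; _∷_)
open import Level using (0ℓ)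
open import Relation.Binary.PropositionalEquality
  using (_≡_; refl; sym; trans; cong; cong₂; subst)
open import Relation.Nullary using (¬_; does)

-- Real numbers: Cauchy sequences of rationals, modulo null sequences.
-- Ring operations, absolute value and maximum act termwise.

IsCauchy : (ℕ → ℚ) → Set
IsCauchy a = ∀ ε → 0ℚ ℚ.< ε →
             ∃[ N ] ∀ m n → N ℕ.≤ m → N ℕ.≤ n → ℚ.∣ a m ℚ.- a n ∣ ℚ.≤ ε

record ℝ : Set where
  constructor mkℝ
  field
    seq    : ℕ → ℚ
    cauchy : IsCauchy seq

open ℝ public

infix 4 _≈_ _≉_ _≤_

record _≈_ (x y : ℝ) : Set where
  constructor mk≈
  field
    close : ∀ ε → 0ℚ ℚ.< ε →
            ∃[ N ] ∀ m → N ℕ.≤ m → ℚ.∣ seq x m ℚ.- seq y m ∣ ℚ.≤ ε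

open _≈_ public

_≉_ : ℝ → ℝ → Set
x ≉ y = ¬ (x ≈ y)

record _≤_ (x y : ℝ) : Set where
  constructor mk≤
  field
    below : ∀ ε → 0ℚ ℚ.< ε →
            ∃[ N ] ∀ m → N ℕ.≤ m → seq x m ℚ.≤ seq y m ℚ.+ ε

open _≤_ public

private
  abstract

    half+half : ∀ ε → ½ ℚ.* ε ℚ.+ ½ ℚ.* ε ≡ ε
    half+half ε = trans (sym (ℚ.*-distribʳ-+ ε ½ ½)) (ℚ.*-identityˡ ε)

    half>0 : ∀ {ε} → 0ℚ ℚ.< ε → 0ℚ ℚ.< ½ ℚ.* ε
    half>0 0<ε = ℚ.*-monoʳ-<-pos ½ 0<ε

    scale : ∀ K ε → 0ℚ ℚ.< K → 0ℚ ℚ.< ε → ∃[ δ ] 0ℚ ℚ.< δ × K ℚ.* δ ≡ ε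
    scale K ε 0<K 0<ε = K⁻¹ ℚ.* ε , pos , eq
      where
      instance
        K-pos : ℚ.Positive K
        K-pos = ℚ.positive 0<K
        K-nonZero : ℚ.NonZero K
        K-nonZero = ℚ.pos⇒nonZero K
      K⁻¹ : ℚ
      K⁻¹ = ℚ.1/ K
      pos : 0ℚ ℚ.< K⁻¹ ℚ.* ε
      pos = subst (ℚ._< K⁻¹ ℚ.* ε) (ℚ.*-zeroʳ K⁻¹)
              (ℚ.*-monoʳ-<-pos K⁻¹ {{ℚ.1/pos⇒pos K}} 0<ε)
      eq : K ℚ.* (K⁻¹ ℚ.* ε) ≡ ε
      eq = trans (sym (ℚ.*-assoc K K⁻¹ ε))
             (trans (cong (ℚ._* ε) (ℚ.*-inverseʳ K)) (ℚ.*-identityˡ ε))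

    p≤∣p∣ : ∀ p → p ℚ.≤ ℚ.∣ p ∣
    p≤∣p∣ p with ℚ.≤-total 0ℚ p
    ... | inj₁ 0≤p = ℚ.≤-reflexive (sym (ℚ.0≤p⇒∣p∣≡p 0≤p))
    ... | inj₂ p≤0 = ℚ.≤-trans p≤0 (ℚ.0≤∣p∣ p)

    ∣p-q∣≡∣q-p∣ : ∀ p q → ℚ.∣ p ℚ.- q ∣ ≡ ℚ.∣ q ℚ.- p ∣
    ∣p-q∣≡∣q-p∣ p q =
      trans (cong ℚ.∣_∣ (solve 2 (λ a b → a :- b := :- (b :- a)) refl p q))
            (ℚ.∣-p∣≡∣p∣ (q ℚ.- p))
      where open +-*-Solver

    p-q≤ε⇒p≤q+ε : ∀ p q {ε} → p ℚ.- q ℚ.≤ ε → p ℚ.≤ q ℚ.+ ε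
    p-q≤ε⇒p≤q+ε p q p-q≤ε =
      subst (ℚ._≤ _) (solve 2 (λ a b → b :+ (a :- b) := a) refl p q)
        (ℚ.+-monoʳ-≤ q p-q≤ε)
      where open +-*-Solver

    p≤q+ε⇒p-q≤ε : ∀ p q {ε} → p ℚ.≤ q ℚ.+ ε → p ℚ.- q ℚ.≤ ε
    p≤q+ε⇒p-q≤ε p q {ε} p≤q+ε =
      subst (_ ℚ.≤_) (solve 2 (λ b e → (b :+ e) :- b := e) refl q ε)
        (ℚ.+-monoˡ-≤ (ℚ.- q) p≤q+ε)
      where open +-*-Solver

    dist≤ : ∀ p q {ε} → ℚ.∣ p ℚ.- q ∣ ℚ.≤ ε → p ℚ.≤ q ℚ.+ ε
    dist≤ p q h = p-q≤ε⇒p≤q+ε p q (ℚ.≤-trans (p≤∣p∣ (p ℚ.- q)) h)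

    dist≥ : ∀ p q {ε} → ℚ.∣ p ℚ.- q ∣ ℚ.≤ ε → q ℚ.≤ p ℚ.+ ε
    dist≥ p q h = dist≤ q p (subst (ℚ._≤ _) (∣p-q∣≡∣q-p∣ p q) h)

    ≤-dist : ∀ p q {ε} → p ℚ.≤ q ℚ.+ ε → q ℚ.≤ p ℚ.+ ε → ℚ.∣ p ℚ.- q ∣ ℚ.≤ ε
    ≤-dist p q p≤ q≤ with ℚ.∣p∣≡p∨∣p∣≡-p (p ℚ.- q)
    ... | inj₁ eq = subst (ℚ._≤ _) (sym eq) (p≤q+ε⇒p-q≤ε p q p≤)
    ... | inj₂ eq = subst (ℚ._≤ _) (sym (trans eq flip)) (p≤q+ε⇒p-q≤ε q p q≤)
      where
      open +-*-Solver
      flip : ℚ.- (p ℚ.- q) ≡ q ℚ.- p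
      flip = solve 2 (λ a b → :- (a :- b) := b :- a) refl p q

    dist-refl : ∀ p {ε} → 0ℚ ℚ.< ε → ℚ.∣ p ℚ.- p ∣ ℚ.≤ ε
    dist-refl p 0<ε =
      subst (ℚ._≤ _) (sym (cong ℚ.∣_∣ (ℚ.+-inverseʳ p))) (ℚ.<⇒≤ 0<ε)

    dist-trans : ∀ p q r {δ ε} → ℚ.∣ p ℚ.- q ∣ ℚ.≤ δ → ℚ.∣ q ℚ.- r ∣ ℚ.≤ ε →
                 ℚ.∣ p ℚ.- r ∣ ℚ.≤ δ ℚ.+ ε
    dist-trans p q r h k =
      subst (λ t → ℚ.∣ t ∣ ℚ.≤ _)
        (solve 3 (λ a b c → (a :- b) :+ (b :- c) := a :- c) refl p q r)
        (ℚ.≤-trans (ℚ.∣p+q∣≤∣p∣+∣q∣ (p ℚ.- q) (q ℚ.- r)) (ℚ.+-mono-≤ h k))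
      where open +-*-Solver

    dist-+ : ∀ p q p′ q′ {δ ε} → ℚ.∣ p ℚ.- p′ ∣ ℚ.≤ δ → ℚ.∣ q ℚ.- q′ ∣ ℚ.≤ ε →
             ℚ.∣ (p ℚ.+ q) ℚ.- (p′ ℚ.+ q′) ∣ ℚ.≤ δ ℚ.+ ε
    dist-+ p q p′ q′ h k =
      subst (λ t → ℚ.∣ t ∣ ℚ.≤ _)
        (solve 4 (λ a b c d → (a :- c) :+ (b :- d) := (a :+ b) :- (c :+ d))
          refl p q p′ q′)
        (ℚ.≤-trans (ℚ.∣p+q∣≤∣p∣+∣q∣ (p ℚ.- p′) (q ℚ.- q′)) (ℚ.+-mono-≤ h k))
      where open +-*-Solver

    dist-neg : ∀ p q {ε} → ℚ.∣ p ℚ.- q ∣ ℚ.≤ ε → ℚ.∣ (ℚ.- p) ℚ.- (ℚ.- q) ∣ ℚ.≤ ε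
    dist-neg p q h =
      subst (ℚ._≤ _)
        (trans (∣p-q∣≡∣q-p∣ p q)
          (cong ℚ.∣_∣ (solve 2 (λ a b → b :- a := (:- a) :- (:- b)) refl p q)))
        h
      where open +-*-Solver

    dist-abs : ∀ p q {ε} → ℚ.∣ p ℚ.- q ∣ ℚ.≤ ε → ℚ.∣ ℚ.∣ p ∣ ℚ.- ℚ.∣ q ∣ ∣ ℚ.≤ ε
    dist-abs p q h =
      ≤-dist ℚ.∣ p ∣ ℚ.∣ q ∣ (bound p q h)
             (bound q p (subst (ℚ._≤ _) (∣p-q∣≡∣q-p∣ p q) h))
      where
      open +-*-Solver
      bound : ∀ p q {ε} → ℚ.∣ p ℚ.- q ∣ ℚ.≤ ε → ℚ.∣ p ∣ ℚ.≤ ℚ.∣ q ∣ ℚ.+ ε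
      bound p q h =
        subst (λ t → ℚ.∣ t ∣ ℚ.≤ _)
          (solve 2 (λ a b → b :+ (a :- b) := a) refl p q)
          (ℚ.≤-trans (ℚ.∣p+q∣≤∣p∣+∣q∣ q (p ℚ.- q)) (ℚ.+-monoʳ-≤ ℚ.∣ q ∣ h))

    dist-⊔ : ∀ p q p′ q′ {ε} → ℚ.∣ p ℚ.- p′ ∣ ℚ.≤ ε → ℚ.∣ q ℚ.- q′ ∣ ℚ.≤ ε →
             ℚ.∣ (p ℚ.⊔ q) ℚ.- (p′ ℚ.⊔ q′) ∣ ℚ.≤ ε
    dist-⊔ p q p′ q′ h k =
      ≤-dist (p ℚ.⊔ q) (p′ ℚ.⊔ q′)
             (bound p q p′ q′ (dist≤ p p′ h) (dist≤ q q′ k))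
             (bound p′ q′ p q (dist≥ p p′ h) (dist≥ q q′ k))
      where
      bound : ∀ p q p′ q′ {ε} → p ℚ.≤ p′ ℚ.+ ε → q ℚ.≤ q′ ℚ.+ ε →
              p ℚ.⊔ q ℚ.≤ (p′ ℚ.⊔ q′) ℚ.+ ε
      bound p q p′ q′ {ε} h k = ℚ.⊔-lub
        (ℚ.≤-trans h (ℚ.+-monoˡ-≤ ε (ℚ.p≤p⊔q p′ q′)))
        (ℚ.≤-trans k (ℚ.+-monoˡ-≤ ε (ℚ.p≤q⊔p p′ q′)))

    dist-* : ∀ p q p′ q′ {K δ} → ℚ.∣ p ∣ ℚ.≤ K → ℚ.∣ q′ ∣ ℚ.≤ K → 0ℚ ℚ.< K →
             ℚ.∣ p ℚ.- p′ ∣ ℚ.≤ δ → ℚ.∣ q ℚ.- q′ ∣ ℚ.≤ δ →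
             ℚ.∣ (p ℚ.* q) ℚ.- (p′ ℚ.* q′) ∣ ℚ.≤ K ℚ.* δ ℚ.+ K ℚ.* δ
    dist-* p q p′ q′ {K} {δ} p≤K q′≤K 0<K h k =
      subst (λ t → ℚ.∣ t ∣ ℚ.≤ _)
        (solve 4 (λ a b c d → a :* (b :- d) :+ d :* (a :- c)
                              := (a :* b) :- (c :* d)) refl p q p′ q′)
        (ℚ.≤-trans (ℚ.∣p+q∣≤∣p∣+∣q∣ (p ℚ.* (q ℚ.- q′)) (q′ ℚ.* (p ℚ.- p′)))
          (ℚ.+-mono-≤ (term p (q ℚ.- q′) p≤K k) (term q′ (p ℚ.- p′) q′≤K h)))
      where
      open +-*-Solver
      term : ∀ a b → ℚ.∣ a ∣ ℚ.≤ K → ℚ.∣ b ∣ ℚ.≤ δ → ℚ.∣ a ℚ.* b ∣ ℚ.≤ K ℚ.* δ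
      term a b a≤K b≤δ = subst (ℚ._≤ _) (sym (ℚ.∣p*q∣≡∣p∣*∣q∣ a b))
        (ℚ.≤-trans (ℚ.*-monoʳ-≤-nonNeg ℚ.∣ b ∣ {{ℚ.∣-∣-nonNeg b}} a≤K)
                   (ℚ.*-monoˡ-≤-nonNeg K
                     {{ℚ.nonNegative (ℚ.<⇒≤ 0<K)}} b≤δ))

    Bounded : ℝ → ℚ → Set
    Bounded x K = ∃[ N ] ∀ m → N ℕ.≤ m → ℚ.∣ seq x m ∣ ℚ.≤ K

    bounded : ∀ x → ∃[ K ] 0ℚ ℚ.< K × Bounded x K
    bounded x with cauchy x 1ℚ (ℚ.positive⁻¹ 1ℚ)
    ... | N , h = B ℚ.+ 1ℚ , 0<B+1 , N , near
      where
      B : ℚ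
      B = ℚ.∣ seq x N ∣
      0<B+1 : 0ℚ ℚ.< B ℚ.+ 1ℚ
      0<B+1 = ℚ.≤-<-trans (ℚ.0≤∣p∣ (seq x N))
        (subst (ℚ._< B ℚ.+ 1ℚ) (ℚ.+-identityʳ B)
          (ℚ.+-monoʳ-< B (ℚ.positive⁻¹ 1ℚ)))
      near : ∀ m → N ℕ.≤ m → ℚ.∣ seq x m ∣ ℚ.≤ B ℚ.+ 1ℚ
      near m N≤m = dist≤ ℚ.∣ seq x m ∣ B {1ℚ}
        (dist-abs (seq x m) (seq x N) {1ℚ} (h m N N≤m ℕ.≤-refl))

    common-bound : ∀ x y → ∃[ K ] 0ℚ ℚ.< K × Bounded x K × Bounded y K
    common-bound x y =
      let K , 0<K , M , b = bounded x
          L , _   , N , c = bounded y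
      in K ℚ.⊔ L , ℚ.<-≤-trans 0<K (ℚ.p≤p⊔q K L)
       , (M , λ m le → ℚ.≤-trans (b m le) (ℚ.p≤p⊔q K L))
       , (N , λ m le → ℚ.≤-trans (c m le) (ℚ.p≤q⊔p K L))

    left : ∀ M N {m} → M ℕ.⊔ N ℕ.≤ m → M ℕ.≤ m
    left M N = ℕ.m⊔n≤o⇒m≤o M N

    right : ∀ M N {m} → M ℕ.⊔ N ℕ.≤ m → N ℕ.≤ m
    right M N = ℕ.m⊔n≤o⇒n≤o M N

    fromℚ-cauchy : ∀ q → IsCauchy (λ _ → q)
    fromℚ-cauchy q ε 0<ε = 0 , λ _ _ _ _ → dist-refl q 0<ε

    +-cauchy : ∀ x y → IsCauchy (λ m → seq x m ℚ.+ seq y m)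
    +-cauchy x y ε 0<ε =
      let M , h = cauchy x (½ ℚ.* ε) (half>0 0<ε)
          N , k = cauchy y (½ ℚ.* ε) (half>0 0<ε)
      in M ℕ.⊔ N , λ m n p q → subst (_ ℚ.≤_) (half+half ε)
           (dist-+ (seq x m) (seq y m) (seq x n) (seq y n)
             (h m n (left M N p) (left M N q)) (k m n (right M N p) (right M N q)))

    neg-cauchy : ∀ x → IsCauchy (λ m → ℚ.- seq x m)
    neg-cauchy x ε 0<ε =
      let N , h = cauchy x ε 0<ε
      in N , λ m n p q → dist-neg (seq x m) (seq x n) (h m n p q)

    *-cauchy : ∀ x y → IsCauchy (λ m → seq x m ℚ.* seq y m)
    *-cauchy x y ε 0<ε =
      let K , 0<K , (A , a) , (B , b) = common-bound x y
          δ , 0<δ , eq = scale K (½ ℚ.* ε) 0<K (half>0 0<ε)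
          M , h = cauchy x δ 0<δ
          N , k = cauchy y δ 0<δ
      in (A ℕ.⊔ B) ℕ.⊔ (M ℕ.⊔ N) , λ m n p q →
         let p₁ = left (A ℕ.⊔ B) (M ℕ.⊔ N) p ; p₂ = right (A ℕ.⊔ B) (M ℕ.⊔ N) p
             q₁ = left (A ℕ.⊔ B) (M ℕ.⊔ N) q ; q₂ = right (A ℕ.⊔ B) (M ℕ.⊔ N) q
         in subst (_ ℚ.≤_) (trans (cong₂ ℚ._+_ eq eq) (half+half ε))
              (dist-* (seq x m) (seq y m) (seq x n) (seq y n)
                (a m (left A B p₁)) (b n (right A B q₁)) 0<K
                (h m n (left M N p₂) (left M N q₂))
                (k m n (right M N p₂) (right M N q₂)))

    abs-cauchy : ∀ x → IsCauchy (λ m → ℚ.∣ seq x m ∣)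
    abs-cauchy x ε 0<ε =
      let N , h = cauchy x ε 0<ε
      in N , λ m n p q → dist-abs (seq x m) (seq x n) (h m n p q)

    ⊔-cauchy : ∀ x y → IsCauchy (λ m → seq x m ℚ.⊔ seq y m)
    ⊔-cauchy x y ε 0<ε =
      let M , h = cauchy x ε 0<ε
          N , k = cauchy y ε 0<ε
      in M ℕ.⊔ N , λ m n p q →
           dist-⊔ (seq x m) (seq y m) (seq x n) (seq y n)
             (h m n (left M N p) (left M N q)) (k m n (right M N p) (right M N q))

fromℚ : ℚ → ℝ
fromℚ q = mkℝ (λ _ → q) (fromℚ-cauchy q)

0ℝ 1ℝ : ℝ
0ℝ = fromℚ 0ℚ
1ℝ = fromℚ 1ℚ

infix  8 -_
infixl 7 _*_
infixl 6 _+_ _-_ _⊔_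

_+_ : ℝ → ℝ → ℝ
x + y = mkℝ (λ m → seq x m ℚ.+ seq y m) (+-cauchy x y)

-_ : ℝ → ℝ
- x = mkℝ (λ m → ℚ.- seq x m) (neg-cauchy x)

_-_ : ℝ → ℝ → ℝ
x - y = x + (- y)

_*_ : ℝ → ℝ → ℝ
x * y = mkℝ (λ m → seq x m ℚ.* seq y m) (*-cauchy x y)

abs : ℝ → ℝ
abs x = mkℝ (λ m → ℚ.∣ seq x m ∣) (abs-cauchy x)

_⊔_ : ℝ → ℝ → ℝ
x ⊔ y = mkℝ (λ m → seq x m ℚ.⊔ seq y m) (⊔-cauchy x y)

abstract

  termwise⇒≈ : ∀ {x y} → (∀ m → seq x m ≡ seq y m) → x ≈ y
  termwise⇒≈ {x} {y} eq .close ε 0<ε = 0 , λ m _ →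
    subst (λ t → ℚ.∣ seq x m ℚ.- t ∣ ℚ.≤ ε) (eq m) (dist-refl (seq x m) 0<ε)

  ≈-refl : ∀ {x} → x ≈ x
  ≈-refl = termwise⇒≈ λ _ → refl

  ≈-sym : ∀ {x y} → x ≈ y → y ≈ x
  ≈-sym {x} {y} x≈y .close ε 0<ε with x≈y .close ε 0<ε
  ... | N , h = N , λ m p →
    subst (ℚ._≤ ε) (∣p-q∣≡∣q-p∣ (seq x m) (seq y m)) (h m p)

  ≈-trans : ∀ {x y z} → x ≈ y → y ≈ z → x ≈ z
  ≈-trans {x} {y} {z} x≈y y≈z .close ε 0<ε
    with x≈y .close (½ ℚ.* ε) (half>0 0<ε) | y≈z .close (½ ℚ.* ε) (half>0 0<ε)
  ... | M , h | N , k = M ℕ.⊔ N , λ m p → subst (_ ℚ.≤_) (half+half ε)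
    (dist-trans (seq x m) (seq y m) (seq z m) (h m (left M N p)) (k m (right M N p)))

  +-cong : ∀ {x x′ y y′} → x ≈ x′ → y ≈ y′ → x + y ≈ x′ + y′
  +-cong {x} {x′} {y} {y′} x≈ y≈ .close ε 0<ε
    with x≈ .close (½ ℚ.* ε) (half>0 0<ε) | y≈ .close (½ ℚ.* ε) (half>0 0<ε)
  ... | M , h | N , k = M ℕ.⊔ N , λ m p → subst (_ ℚ.≤_) (half+half ε)
    (dist-+ (seq x m) (seq y m) (seq x′ m) (seq y′ m)
      (h m (left M N p)) (k m (right M N p)))

  -‿cong : ∀ {x y} → x ≈ y → - x ≈ - y
  -‿cong {x} {y} x≈y .close ε 0<ε with x≈y .close ε 0<ε
  ... | N , h = N , λ m p → dist-neg (seq x m) (seq y m) (h m p)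

  *-cong : ∀ {x x′ y y′} → x ≈ x′ → y ≈ y′ → x * y ≈ x′ * y′
  *-cong {x} {x′} {y} {y′} x≈ y≈ .close ε 0<ε =
    let K , 0<K , (A , a) , (B , b) = common-bound x y′
        δ , 0<δ , eq = scale K (½ ℚ.* ε) 0<K (half>0 0<ε)
        M , h = x≈ .close δ 0<δ
        N , k = y≈ .close δ 0<δ
    in (A ℕ.⊔ B) ℕ.⊔ (M ℕ.⊔ N) , λ m p →
       let p₁ = left (A ℕ.⊔ B) (M ℕ.⊔ N) p ; p₂ = right (A ℕ.⊔ B) (M ℕ.⊔ N) p
       in subst (_ ℚ.≤_) (trans (cong₂ ℚ._+_ eq eq) (half+half ε))
            (dist-* (seq x m) (seq y m) (seq x′ m) (seq y′ m)
              (a m (left A B p₁)) (b m (right A B p₁)) 0<K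
              (h m (left M N p₂)) (k m (right M N p₂)))

+-*-isCommutativeRing : IsCommutativeRing _≈_ _+_ _*_ -_ 0ℝ 1ℝ
+-*-isCommutativeRing = record
  { isRing = record
    { +-isAbelianGroup = record
      { isGroup = record
        { isMonoid = record
          { isSemigroup = record
            { isMagma = record
              { isEquivalence = record
                { refl  = ≈-refl
                ; sym   = ≈-sym
                ; trans = ≈-trans
                }
              ; ∙-cong = +-cong
              }
            ; assoc = λ x y z → termwise⇒≈ λ m →
                ℚ.+-assoc (seq x m) (seq y m) (seq z m)
            }
          ; identity = (λ x → termwise⇒≈ λ m → ℚ.+-identityˡ (seq x m))
                     , (λ x → termwise⇒≈ λ m → ℚ.+-identityʳ (seq x m))
          }
        ; inverse = (λ x → termwise⇒≈ λ m → ℚ.+-inverseˡ (seq x m))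
                  , (λ x → termwise⇒≈ λ m → ℚ.+-inverseʳ (seq x m))
        ; ⁻¹-cong = -‿cong
        }
      ; comm = λ x y → termwise⇒≈ λ m → ℚ.+-comm (seq x m) (seq y m)
      }
    ; *-cong = *-cong
    ; *-assoc = λ x y z → termwise⇒≈ λ m →
        ℚ.*-assoc (seq x m) (seq y m) (seq z m)
    ; *-identity = (λ x → termwise⇒≈ λ m → ℚ.*-identityˡ (seq x m))
                 , (λ x → termwise⇒≈ λ m → ℚ.*-identityʳ (seq x m))
    ; distrib = (λ x y z → termwise⇒≈ λ m →
                  ℚ.*-distribˡ-+ (seq x m) (seq y m) (seq z m))
              , (λ x y z → termwise⇒≈ λ m →
                  ℚ.*-distribʳ-+ (seq x m) (seq y m) (seq z m))
    }
  ; *-comm = λ x y → termwise⇒≈ λ m → ℚ.*-comm (seq x m) (seq y m)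
  }

+-*-commutativeRing : CommutativeRing 0ℓ 0ℓ
+-*-commutativeRing = record { isCommutativeRing = +-*-isCommutativeRing }

Cube : ℕ → Set
Cube = Vec Sign

sign : Sign → ℝ
sign plus  = 1ℝ
sign minus = - 1ℝ

χ : ∀ {n} → Subset n → Cube n → ℝ
χ []            []       = 1ℝ
χ (inside  ∷ S) (x ∷ xs) = sign x * χ S xs
χ (outside ∷ S) (x ∷ xs) = χ S xs

∑⊆ : ∀ n → (Subset n → ℝ) → ℝ
∑⊆ zero    g = g []
∑⊆ (suc n) g = ∑⊆ n (λ S → g (outside ∷ S)) + ∑⊆ n (λ S → g (inside ∷ S))

IsFourierExpansion : ∀ {n} → (Cube n → ℝ) → (Subset n → ℝ) → Set
IsFourierExpansion {n} f f̂ = ∀ x → f x ≈ ∑⊆ n (λ S → f̂ S * χ S x)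

-- The degree of the multilinear polynomial with coefficients f̂; the zero
-- polynomial is given degree 0.
HasDegree : ∀ {n} → (Subset n → ℝ) → ℕ → Set
HasDegree {n} f̂ d =
  (∀ S → d ℕ.< ∣ S ∣ → f̂ S ≈ 0ℝ) ×
  (d ≡ 0 ⊎ ∃[ S ] ∣ S ∣ ≡ d × f̂ S ≉ 0ℝ)

homogeneousPart : ∀ {n} → (Subset n → ℝ) → ℕ → Cube n → ℝ
homogeneousPart {n} f̂ ℓ x =
  ∑⊆ n (λ S → if does (∣ S ∣ ℕ.≟ ℓ) then f̂ S * χ S x else 0ℝ)

maxCube : ∀ n → (Cube n → ℝ) → ℝ
maxCube zero    g = g []
maxCube (suc n) g = maxCube n (λ x → g (plus ∷ x)) ⊔ maxCube n (λ x → g (minus ∷ x))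

‖_‖∞ : ∀ {n} → (Cube n → ℝ) → ℝ
‖_‖∞ {n} g = maxCube n (λ x → abs (g x))

-- Angles modulo 2π, represented as points (cos θ, sin θ) of the unit circle
-- and added by rotation, so that d · θ is the d-fold sum of θ.

record Angle : Set where
  field
    cos sin    : ℝ
    onCircle   : cos * cos + sin * sin ≈ 1ℝ

open Angle public

0° : Angle
0° = record
  { cos = 1ℝ
  ; sin = 0ℝ
  ; onCircle = termwise⇒≈ λ _ →
      trans (cong₂ ℚ._+_ (ℚ.*-identityˡ 1ℚ) (ℚ.*-zeroˡ 0ℚ)) (ℚ.+-identityʳ 1ℚ)
  }

infixl 6 _⊕_
infixl 7 _·_

_⊕_ : Angle → Angle → Angle
θ ⊕ φ = record
  { cos = cos θ * cos φ - sin θ * sin φ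
  ; sin = sin θ * cos φ + cos θ * sin φ
  ; onCircle = ≈-trans lagrange
      (≈-trans (*-cong (onCircle θ) (onCircle φ))
        (termwise⇒≈ λ _ → ℚ.*-identityˡ 1ℚ))
  }
  where
  open +-*-Solver
  c s c′ s′ : ℝ
  c = cos θ ; s = sin θ ; c′ = cos φ ; s′ = sin φ
  lagrange : (c * c′ - s * s′) * (c * c′ - s * s′) + (s * c′ + c * s′) * (s * c′ + c * s′)
             ≈ (c * c + s * s) * (c′ * c′ + s′ * s′)
  lagrange = termwise⇒≈ λ m → solve 4 (λ a b a′ b′ →
      (a :* a′ :- b :* b′) :* (a :* a′ :- b :* b′) :+
      (b :* a′ :+ a :* b′) :* (b :* a′ :+ a :* b′)
      := (a :* a :+ b :* b) :* (a′ :* a′ :+ b′ :* b′))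
    refl (seq c m) (seq s m) (seq c′ m) (seq s′ m)

_·_ : ℕ → Angle → Angle
zero  · θ = 0°
suc d · θ = θ ⊕ d · θ

-- Univariate polynomials, as lists of coefficients starting from the
-- constant one.

Poly : Set
Poly = List ℝ

coeff : Poly → ℕ → ℝ
coeff []      _       = 0ℝ
coeff (a ∷ p) zero    = a
coeff (a ∷ p) (suc k) = coeff p k

eval : Poly → ℝ → ℝ
eval []      z = 0ℝ
eval (a ∷ p) z = a + z * eval p z

record IsChebyshev (d : ℕ) (T : Poly) : Set where
  field
    leading : coeff T d ≉ 0ℝ
    higher  : ∀ k → d ℕ.< k → coeff T k ≈ 0ℝ
    cosine  : ∀ θ → eval T (cos θ) ≈ cos (d · θ)

{-# OPTIONS --safe #-}
module Submission where

-- Fix a vertex x of the cube.  On the segment t x with t between -1 and 1, the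
-- multilinear polynomial of f takes the values p(t), the sum of f_i(x) t^i, and
-- these lie between -1 and 1 because a multilinear polynomial on the cube is an
-- average of its values at the vertices (homogeneous-small).  So the claim is
-- V. A. Markov's bound for the coefficients of a polynomial p of degree at most
-- d that is bounded by 1 on the interval (module MarkovBound).  Let e be d or
-- d - 1, whichever has the parity of ℓ.
--
-- Only the part of p with the parity of ℓ matters.  It is half the sum or the
-- difference of p(t) and p(-t), hence still bounded by 1, and it has degree at
-- most e.  Up to a factor t^r, where r is the remainder of e modulo 2, it is a
-- polynomial in u = t² of degree at most m, the quotient of e by 2; so is T_e.
-- There are u_0 > ... > u_m > 0 close to the squares of the nonnegative extrema
-- of T_e where T_e takes values within δ of 1, -1, 1, ..., so that this part of
-- T_e + (1 - δ) p and of T_e - (1 - δ) p has alternating signs there.  A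
-- polynomial of degree at most m with alternating signs at m + 1 positive points
-- has coefficients of alternating signs (alternating-coefficients); hence
-- (1 - δ) |p_ℓ| is at most the absolute value of the coefficient of T_e, and δ
-- tends to 0 (≤-limit).  Working with a small δ > 0 allows all points to be rational.
--
-- Alternation of the coefficients is proved by induction on m with Neville's
-- identity (u_0 - u_m) q = (z - u_m) A - (z - u_0) D, where A and D are the
-- polynomials of degree m - 1 that agree with q at all points but the last and
-- at all points but the first: each of the four terms that make up a
-- coefficient of the right-hand side has the required sign.
--
-- The points are cosines of multiples of a rational rotation (extrema-exist).
-- Rotate by a very small rational angle until the sine is no longer positive,
-- which takes K steps and is almost a half turn.  If M is about K / e, then M
-- steps make almost an e-th part of a half turn, and the extrema are close to
-- the cosines of its multiples.

open import Defs
open import Algebra.Bundles using (CommutativeRing)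
open import Data.Bool.Base using (true; false; if_then_else_; T)
open import Data.Empty using (⊥; ⊥-elim)
open import Data.Fin.Subset using (Subset; inside; outside; ∣_∣)
open import Data.Fin.Subset.Properties using (∣p∣≤n)
import Data.Integer.Base as ℤ
import Data.Integer.Properties as ℤ
open import Data.List.Base using ([]; _∷_)
open import Data.Nat.Base as ℕ using (ℕ; zero; suc; _∸_; _%_)
import Data.Nat.DivMod as ℕ
import Data.Nat.Properties as ℕ
open import Data.Nat.Solver using () renaming (module +-*-Solver to ℕ-Solver)
open import Data.Product.Base using (∃-syntax; _×_; _,_; proj₁; proj₂)
open import Data.Rational.Base as ℚ using (ℚ; 0ℚ; 1ℚ; ½)
import Data.Rational.Properties as ℚ
open import Data.Rational.Solver using (module +-*-Solver)
import Data.Rational.Unnormalised.Base as ℚᵘ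
import Data.Rational.Unnormalised.Properties as ℚᵘ
open import Data.Sign.Base using (Sign) renaming (+ to plus; - to minus)
open import Data.Sum.Base using (_⊎_; inj₁; inj₂; [_,_]′)
open import Data.Unit.Base using (tt)
open import Data.Vec.Base using (Vec; []; _∷_; map)
open import Data.Vec.Relation.Unary.All using (All; []; _∷_)
open import Relation.Binary.Definitions using (tri<; tri≈; tri>)
open import Relation.Binary.PropositionalEquality
  using (_≡_; _≢_; refl; sym; trans; cong; cong₂; subst; subst₂)
open import Relation.Nullary using (Dec; does; yes; no; ¬_)

open CommutativeRing +-*-commutativeRing
  using (setoid; -‿inverseʳ; zeroʳ)
  renaming (+-identityˡ to 0+; +-identityʳ to +0; *-identityˡ to 1*)
open import Relation.Binary.Reasoning.Setoid setoid using (begin_; step-≈-⟩; _∎)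
open +-*-Solver using (solve; _:=_; _:+_; _:*_; _:-_; :-_; con)
open ℕ-Solver using () renaming
  (solve to ℕ-solve; _:=_ to _≔_; _:*_ to _⊛_; _:+_ to _⊞_; con to ℕ-con)

-- Ordered arithmetic of the rationals

0≤q-p : ∀ {p q} → p ℚ.≤ q → 0ℚ ℚ.≤ q ℚ.- p
0≤q-p {p} {q} p≤q = subst (ℚ._≤ q ℚ.- p) (ℚ.+-inverseʳ p) (ℚ.+-monoˡ-≤ (ℚ.- p) p≤q)

p+[q-p]≡q : ∀ p q → p ℚ.+ (q ℚ.- p) ≡ q
p+[q-p]≡q = solve 2 (λ p q → p :+ (q :- p) := q) refl

[q-p]+p≡q : ∀ p q → (q ℚ.- p) ℚ.+ p ≡ q
[q-p]+p≡q = solve 2 (λ p q → (q :- p) :+ p := q) refl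

0≤q-p⁻¹ : ∀ {p q} → 0ℚ ℚ.≤ q ℚ.- p → p ℚ.≤ q
0≤q-p⁻¹ {p} {q} h = subst₂ ℚ._≤_ (ℚ.+-identityʳ p) (p+[q-p]≡q p q)
  (ℚ.+-monoʳ-≤ p {0ℚ} {q ℚ.- p} h)

0<q-p : ∀ {p q} → p ℚ.< q → 0ℚ ℚ.< q ℚ.- p
0<q-p {p} {q} p<q = subst (ℚ._< q ℚ.- p) (ℚ.+-inverseʳ p) (ℚ.+-monoˡ-< (ℚ.- p) p<q)

0<q-p⁻¹ : ∀ {p q} → 0ℚ ℚ.< q ℚ.- p → p ℚ.< q
0<q-p⁻¹ {p} {q} h = subst₂ ℚ._<_ (ℚ.+-identityʳ p) (p+[q-p]≡q p q)
  (ℚ.+-monoʳ-< p {0ℚ} {q ℚ.- p} h)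

0≤+ : ∀ {p q} → 0ℚ ℚ.≤ p → 0ℚ ℚ.≤ q → 0ℚ ℚ.≤ p ℚ.+ q
0≤+ {p} {q} 0≤p 0≤q = subst (ℚ._≤ p ℚ.+ q) (ℚ.+-identityˡ 0ℚ) (ℚ.+-mono-≤ 0≤p 0≤q)

0<+0≤ : ∀ {p q} → 0ℚ ℚ.< p → 0ℚ ℚ.≤ q → 0ℚ ℚ.< p ℚ.+ q
0<+0≤ {p} {q} 0<p 0≤q = subst (ℚ._< p ℚ.+ q) (ℚ.+-identityˡ 0ℚ) (ℚ.+-mono-<-≤ 0<p 0≤q)

0≤* : ∀ {p q} → 0ℚ ℚ.≤ p → 0ℚ ℚ.≤ q → 0ℚ ℚ.≤ p ℚ.* q
0≤* {p} {q} 0≤p 0≤q = subst (ℚ._≤ p ℚ.* q) (ℚ.*-zeroʳ p)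
  (ℚ.*-monoˡ-≤-nonNeg p {{ℚ.nonNegative 0≤p}} 0≤q)

0<* : ∀ {p q} → 0ℚ ℚ.< p → 0ℚ ℚ.< q → 0ℚ ℚ.< p ℚ.* q
0<* {p} {q} 0<p 0<q = subst (ℚ._< p ℚ.* q) (ℚ.*-zeroʳ p)
  (ℚ.*-monoʳ-<-pos p {{ℚ.positive 0<p}} 0<q)

0<*-cancelˡ : ∀ {p q} → 0ℚ ℚ.≤ p → 0ℚ ℚ.< p ℚ.* q → 0ℚ ℚ.< q
0<*-cancelˡ {p} {q} 0≤p h = ℚ.*-cancelˡ-<-nonNeg p {{ℚ.nonNegative 0≤p}}
  (subst (ℚ._< p ℚ.* q) (sym (ℚ.*-zeroʳ p)) h)

neg*neg : ∀ p → (ℚ.- p) ℚ.* (ℚ.- p) ≡ p ℚ.* p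
neg*neg = solve 1 (λ p → (:- p) :* (:- p) := p :* p) refl

0≤p*p : ∀ p → 0ℚ ℚ.≤ p ℚ.* p
0≤p*p p with ℚ.≤-total 0ℚ p
... | inj₁ 0≤p = 0≤* 0≤p 0≤p
... | inj₂ p≤0 = subst (0ℚ ℚ.≤_) (neg*neg p) (0≤* 0≤-p 0≤-p)
  where
  0≤-p : 0ℚ ℚ.≤ ℚ.- p
  0≤-p = ℚ.neg-antimono-≤ p≤0

p≤∣p∣ : ∀ p → p ℚ.≤ ℚ.∣ p ∣
p≤∣p∣ p with ℚ.≤-total 0ℚ p
... | inj₁ 0≤p = ℚ.≤-reflexive (sym (ℚ.0≤p⇒∣p∣≡p 0≤p))
... | inj₂ p≤0 = ℚ.≤-trans p≤0 (ℚ.0≤∣p∣ p)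

-p≤∣p∣ : ∀ p → ℚ.- p ℚ.≤ ℚ.∣ p ∣
-p≤∣p∣ p = subst (ℚ.- p ℚ.≤_) (ℚ.∣-p∣≡∣p∣ p) (p≤∣p∣ (ℚ.- p))

inverse : ∀ p → 0ℚ ℚ.< p → ∃[ r ] 0ℚ ℚ.< r × r ℚ.* p ≡ 1ℚ
inverse p 0<p = (ℚ.1/ p) {{p≢0}}
              , ℚ.positive⁻¹ ((ℚ.1/ p) {{p≢0}}) {{ℚ.1/pos⇒pos p {{ℚ.positive 0<p}}}}
              , ℚ.*-inverseˡ p {{p≢0}}
  where
  p≢0 : ℚ.NonZero p
  p≢0 = ℚ.pos⇒nonZero p {{ℚ.positive 0<p}}

inverse-cancel : ∀ r p q → r ℚ.* p ≡ 1ℚ → (r ℚ.* p) ℚ.* q ≡ q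
inverse-cancel r p q eq = subst (λ t → t ℚ.* q ≡ q) (sym eq) (ℚ.*-identityˡ q)

0<1 : 0ℚ ℚ.< 1ℚ
0<1 = ℚ.positive⁻¹ 1ℚ

-- The order of the reals as an ordered vector space over the rationals

half>0 : ∀ {ε} → 0ℚ ℚ.< ε → 0ℚ ℚ.< ½ ℚ.* ε
half>0 = 0<* (ℚ.positive⁻¹ ½)

halves : ∀ p ε → (p ℚ.+ ½ ℚ.* ε) ℚ.+ ½ ℚ.* ε ≡ p ℚ.+ ε
halves = solve 2 (λ p ε → (p :+ con ½ :* ε) :+ con ½ :* ε := p :+ ε) refl

halves′ : ∀ p q ε → (p ℚ.+ ½ ℚ.* ε) ℚ.+ (q ℚ.+ ½ ℚ.* ε) ≡ (p ℚ.+ q) ℚ.+ ε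
halves′ = solve 3 (λ p q ε → (p :+ con ½ :* ε) :+ (q :+ con ½ :* ε) := (p :+ q) :+ ε) refl

ℕ-left : ∀ M N {m} → M ℕ.⊔ N ℕ.≤ m → M ℕ.≤ m
ℕ-left M N = ℕ.m⊔n≤o⇒m≤o M N

ℕ-right : ∀ M N {m} → M ℕ.⊔ N ℕ.≤ m → N ℕ.≤ m
ℕ-right M N = ℕ.m⊔n≤o⇒n≤o M N

+-mono-≤ : ∀ {x y z w} → x ≤ y → z ≤ w → x + z ≤ y + w
+-mono-≤ {x} {y} {z} {w} x≤y z≤w .below ε 0<ε
  with x≤y .below (½ ℚ.* ε) (half>0 0<ε) | z≤w .below (½ ℚ.* ε) (half>0 0<ε)
... | M , h | N , k = M ℕ.⊔ N , λ m p →
  subst (seq x m ℚ.+ seq z m ℚ.≤_)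
    (halves′ (seq y m) (seq w m) ε)
    (ℚ.+-mono-≤ (h m (ℕ-left M N p)) (k m (ℕ-right M N p)))

≤-trans : ∀ {x y z} → x ≤ y → y ≤ z → x ≤ z
≤-trans {x} {y} {z} x≤y y≤z .below ε 0<ε
  with x≤y .below (½ ℚ.* ε) (half>0 0<ε) | y≤z .below (½ ℚ.* ε) (half>0 0<ε)
... | M , h | N , k = M ℕ.⊔ N , λ m p →
  subst (seq x m ℚ.≤_)
    (halves (seq z m) ε)
    (ℚ.≤-trans (h m (ℕ-left M N p)) (ℚ.+-monoˡ-≤ (½ ℚ.* ε) (k m (ℕ-right M N p))))

≤-reflexive : ∀ {x y} → x ≈ y → x ≤ y
≤-reflexive {x} {y} x≈y .below ε 0<ε with x≈y .close ε 0<ε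
... | N , h = N , λ m p → bound m (h m p)
  where
  bound : ∀ m → ℚ.∣ seq x m ℚ.- seq y m ∣ ℚ.≤ ε → seq x m ℚ.≤ seq y m ℚ.+ ε
  bound m h = subst (ℚ._≤ seq y m ℚ.+ ε) (p+[q-p]≡q (seq y m) (seq x m))
    (ℚ.+-monoʳ-≤ (seq y m) (ℚ.≤-trans (p≤∣p∣ (seq x m ℚ.- seq y m)) h))

termwise⇒≤ : ∀ {x y} → (∀ m → seq x m ℚ.≤ seq y m) → x ≤ y
termwise⇒≤ {x} {y} h .below ε 0<ε = 0 , λ m _ →
  subst (ℚ._≤ seq y m ℚ.+ ε) (ℚ.+-identityʳ (seq x m))
    (ℚ.+-mono-≤ (h m) (ℚ.<⇒≤ 0<ε))

fromℚ-mono : ∀ {p q} → p ℚ.≤ q → fromℚ p ≤ fromℚ q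
fromℚ-mono p≤q = termwise⇒≤ λ _ → p≤q

fromℚ-*-mono : ∀ {q x y} → 0ℚ ℚ.< q → x ≤ y → fromℚ q * x ≤ fromℚ q * y
fromℚ-*-mono {q} {x} {y} 0<q x≤y .below ε 0<ε with inverse q 0<q
... | r , 0<r , rq≡1 with x≤y .below (r ℚ.* ε) (0<* 0<r 0<ε)
... | N , h = N , λ m p → subst (q ℚ.* seq x m ℚ.≤_) (eq (seq y m))
  (ℚ.*-monoˡ-≤-nonNeg q {{ℚ.nonNegative (ℚ.<⇒≤ 0<q)}} (h m p))
  where
  expand : ∀ q y r ε → q ℚ.* (y ℚ.+ r ℚ.* ε) ≡ q ℚ.* y ℚ.+ (r ℚ.* q) ℚ.* ε
  expand = solve 4 (λ q y r ε → q :* (y :+ r :* ε) := q :* y :+ (r :* q) :* ε) refl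
  rqε≡ε : (r ℚ.* q) ℚ.* ε ≡ ε
  rqε≡ε = inverse-cancel r q ε rq≡1
  eq : ∀ y → q ℚ.* (y ℚ.+ r ℚ.* ε) ≡ q ℚ.* y ℚ.+ ε
  eq y = subst (λ t → q ℚ.* (y ℚ.+ r ℚ.* ε) ≡ q ℚ.* y ℚ.+ t) rqε≡ε (expand q y r ε)

0≤-cong : ∀ {x y} → x ≈ y → 0ℝ ≤ x → 0ℝ ≤ y
0≤-cong x≈y 0≤x = ≤-trans 0≤x (≤-reflexive x≈y)

0≤-+ : ∀ {x y} → 0ℝ ≤ x → 0ℝ ≤ y → 0ℝ ≤ x + y
0≤-+ 0≤x 0≤y = ≤-trans (≤-reflexive (≈-sym (0+ 0ℝ))) (+-mono-≤ 0≤x 0≤y)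

0≤-scale : ∀ {q x} → 0ℚ ℚ.≤ q → 0ℝ ≤ x → 0ℝ ≤ fromℚ q * x
0≤-scale {q} {x} 0≤q 0≤x with ℚ.<-cmp 0ℚ q
... | tri< 0<q _ _ = ≤-trans (≤-reflexive (≈-sym (zeroʳ (fromℚ q)))) (fromℚ-*-mono 0<q 0≤x)
... | tri≈ _ 0≡q _ = ≤-reflexive (termwise⇒≈ λ m →
        subst (λ t → 0ℚ ≡ t ℚ.* seq x m) 0≡q (sym (ℚ.*-zeroˡ (seq x m))))
... | tri> _ _ q<0 = ⊥-elim (ℚ.<-irrefl refl (ℚ.<-≤-trans q<0 0≤q))

0≤-unscale : ∀ {q x} → 0ℚ ℚ.< q → 0ℝ ≤ fromℚ q * x → 0ℝ ≤ x
0≤-unscale {q} {x} 0<q h with inverse q 0<q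
... | r , 0<r , rq≡1 = 0≤-cong (termwise⇒≈ cancel) (0≤-scale (ℚ.<⇒≤ 0<r) h)
  where
  cancel : ∀ m → r ℚ.* (q ℚ.* seq x m) ≡ seq x m
  cancel m = subst (_≡ seq x m) (ℚ.*-assoc r q (seq x m)) (inverse-cancel r q (seq x m) rq≡1)

0≤y-x : ∀ {x y} → x ≤ y → 0ℝ ≤ y - x
0≤y-x {x} x≤y = ≤-trans (≤-reflexive (≈-sym (-‿inverseʳ x)))
  (+-mono-≤ x≤y (≤-reflexive ≈-refl))

0≤y-x⁻¹ : ∀ {x y} → 0ℝ ≤ y - x → x ≤ y
0≤y-x⁻¹ {x} {y} h = ≤-trans (≤-reflexive (≈-sym (0+ x)))
  (≤-trans (+-mono-≤ h (≤-reflexive ≈-refl))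
    (≤-reflexive (termwise⇒≈ λ m → [q-p]+p≡q (seq x m) (seq y m))))

∣x∣≤ : ∀ {x y} → x ≤ y → - x ≤ y → abs x ≤ y
∣x∣≤ {x} {y} x≤y -x≤y .below ε 0<ε with x≤y .below ε 0<ε | -x≤y .below ε 0<ε
... | M , h | N , k = M ℕ.⊔ N , λ m p → bound m (h m (ℕ-left M N p)) (k m (ℕ-right M N p))
  where
  bound : ∀ m → seq x m ℚ.≤ seq y m ℚ.+ ε → ℚ.- seq x m ℚ.≤ seq y m ℚ.+ ε →
          ℚ.∣ seq x m ∣ ℚ.≤ seq y m ℚ.+ ε
  bound m h k with ℚ.∣p∣≡p∨∣p∣≡-p (seq x m)
  ... | inj₁ eq = subst (ℚ._≤ _) (sym eq) h
  ... | inj₂ eq = subst (ℚ._≤ _) (sym eq) k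

⊔-lub : ∀ {x y z} → x ≤ z → y ≤ z → x ⊔ y ≤ z
⊔-lub x≤z y≤z .below ε 0<ε with x≤z .below ε 0<ε | y≤z .below ε 0<ε
... | M , h | N , k = M ℕ.⊔ N , λ m p →
  ℚ.⊔-lub (h m (ℕ-left M N p)) (k m (ℕ-right M N p))

-- A real number is eventually bounded by a positive rational.
bounded : ∀ x → ∃[ K ] 0ℚ ℚ.< K × ∃[ N ] ∀ m → N ℕ.≤ m → seq x m ℚ.≤ K
bounded x with cauchy x 1ℚ 0<1
... | N , h = ℚ.∣ seq x N ∣ ℚ.+ 1ℚ
  , subst (0ℚ ℚ.<_) (ℚ.+-comm 1ℚ ℚ.∣ seq x N ∣) (0<+0≤ 0<1 (ℚ.0≤∣p∣ (seq x N)))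
  , N , λ m N≤m → bound m (h m N N≤m ℕ.≤-refl)
  where
  bound : ∀ m → ℚ.∣ seq x m ℚ.- seq x N ∣ ℚ.≤ 1ℚ → seq x m ℚ.≤ ℚ.∣ seq x N ∣ ℚ.+ 1ℚ
  bound m h = subst (ℚ._≤ ℚ.∣ seq x N ∣ ℚ.+ 1ℚ) (p+[q-p]≡q (seq x N) (seq x m))
    (ℚ.+-mono-≤ (p≤∣p∣ (seq x N)) (ℚ.≤-trans (p≤∣p∣ (seq x m ℚ.- seq x N)) h))

-- Given bounds K and ε, some positive δ ≤ 1 has δ * K ≤ ε.
small-multiplier : ∀ K ε → 0ℚ ℚ.< K → 0ℚ ℚ.< ε →
                   ∃[ δ ] 0ℚ ℚ.< δ × δ ℚ.≤ 1ℚ × δ ℚ.* K ℚ.≤ ε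
small-multiplier K ε 0<K 0<ε with inverse K 0<K
... | r , 0<r , rK≡1 = 1ℚ ℚ.⊓ (r ℚ.* ε) , 0<δ , ℚ.p⊓q≤p 1ℚ (r ℚ.* ε) , δK≤ε
  where
  0<δ : 0ℚ ℚ.< 1ℚ ℚ.⊓ (r ℚ.* ε)
  0<δ with ℚ.⊓-sel 1ℚ (r ℚ.* ε)
  ... | inj₁ eq = subst (0ℚ ℚ.<_) (sym eq) 0<1
  ... | inj₂ eq = subst (0ℚ ℚ.<_) (sym eq) (0<* 0<r 0<ε)
  swap : ∀ r K e → (r ℚ.* K) ℚ.* e ≡ (r ℚ.* e) ℚ.* K
  swap = solve 3 (λ r K e → (r :* K) :* e := (r :* e) :* K) refl
  rεK≡ε : (r ℚ.* ε) ℚ.* K ≡ ε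
  rεK≡ε = subst (_≡ ε) (swap r K ε) (inverse-cancel r K ε rK≡1)
  δK≤ε : (1ℚ ℚ.⊓ (r ℚ.* ε)) ℚ.* K ℚ.≤ ε
  δK≤ε = subst ((1ℚ ℚ.⊓ (r ℚ.* ε)) ℚ.* K ℚ.≤_) rεK≡ε
    (ℚ.*-monoʳ-≤-nonNeg K {{ℚ.nonNegative (ℚ.<⇒≤ 0<K)}} (ℚ.p⊓q≤q 1ℚ (r ℚ.* ε)))

split-off : ∀ d x → (1ℚ ℚ.- d) ℚ.* x ℚ.+ d ℚ.* x ≡ x
split-off = solve 2 (λ d x → (con 1ℚ :- d) :* x :+ d :* x := x) refl

-- An inequality may be proved up to factors arbitrarily close to 1, because x is
-- bounded above.
≤-limit : ∀ {x y} →
  (∀ δ → 0ℚ ℚ.< δ → δ ℚ.≤ 1ℚ → fromℚ (1ℚ ℚ.- δ) * x ≤ y) → x ≤ y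
≤-limit {x} {y} h .below ε 0<ε =
  let K , 0<K , M , x≤K = bounded x
      δ , 0<δ , δ≤1 , δK≤ = small-multiplier K (½ ℚ.* ε) 0<K (half>0 0<ε)
      N , k = h δ 0<δ δ≤1 .below (½ ℚ.* ε) (half>0 0<ε)
      δx≤ : ∀ m → M ℕ.≤ m → δ ℚ.* seq x m ℚ.≤ ½ ℚ.* ε
      δx≤ = λ m p → ℚ.≤-trans
        (ℚ.*-monoˡ-≤-nonNeg δ {{ℚ.nonNegative (ℚ.<⇒≤ 0<δ)}} (x≤K m p)) δK≤
  in M ℕ.⊔ N , λ m p → subst₂ ℚ._≤_ (split-off δ (seq x m)) (halves (seq y m) ε)
       (ℚ.+-mono-≤ (k m (ℕ-right M N p)) (δx≤ m (ℕ-left M N p)))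

-- Polynomials as coefficient sequences

-- The value at a rational t of the polynomial with coefficients
-- c 0, ..., c (N - 1).
value : ℕ → (ℕ → ℝ) → ℚ → ℝ
value zero    c t = 0ℝ
value (suc N) c t = c 0 + fromℚ t * value N (λ i → c (suc i)) t

value-cong : ∀ N {c c′} t → (∀ i → c i ≈ c′ i) → value N c t ≈ value N c′ t
value-cong zero    t h = ≈-refl
value-cong (suc N) t h = +-cong (h 0) (*-cong ≈-refl (value-cong N t (λ i → h (suc i))))

value-linear : ∀ N c k c′ t →
  value N (λ i → c i + k * c′ i) t ≈ value N c t + k * value N c′ t
value-linear zero    c k c′ t = ≈-sym (≈-trans (0+ (k * 0ℝ)) (zeroʳ k))
value-linear (suc N) c k c′ t = ≈-trans
  (+-cong ≈-refl (*-cong ≈-refl (value-linear N (λ i → c (suc i)) k (λ i → c′ (suc i)) t)))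
  (termwise⇒≈ λ m → regroup (seq (c 0) m) (seq k m) (seq (c′ 0) m) t
     (seq (value N (λ i → c (suc i)) t) m) (seq (value N (λ i → c′ (suc i)) t) m))
  where
  regroup : ∀ c k c′ t v v′ → (c ℚ.+ k ℚ.* c′) ℚ.+ t ℚ.* (v ℚ.+ k ℚ.* v′) ≡
                              (c ℚ.+ t ℚ.* v) ℚ.+ k ℚ.* (c′ ℚ.+ t ℚ.* v′)
  regroup = solve 6 (λ c k c′ t v v′ → (c :+ k :* c′) :+ t :* (v :+ k :* v′) :=
                                       (c :+ t :* v) :+ k :* (c′ :+ t :* v′)) refl

*-zero : ∀ x {y} → y ≈ 0ℝ → x * y ≈ 0ℝ
*-zero x y≈0 = ≈-trans (*-cong (≈-refl {x}) y≈0) (zeroʳ x)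

value-zero : ∀ N {c} t → (∀ i → c i ≈ 0ℝ) → value N c t ≈ 0ℝ
value-zero zero    t h = ≈-refl
value-zero (suc N) t h = ≈-trans
  (+-cong (h 0) (*-cong ≈-refl (value-zero N t (λ i → h (suc i)))))
  (≈-trans (0+ _) (zeroʳ (fromℚ t)))

value-extend : ∀ {N N′} {c} t → N ℕ.≤ N′ → (∀ i → N ℕ.≤ i → c i ≈ 0ℝ) →
               value N′ c t ≈ value N c t
value-extend {zero} {N′} t ℕ.z≤n     h = value-zero N′ t (λ i → h i ℕ.z≤n)
value-extend             t (ℕ.s≤s p) h = +-cong ≈-refl (*-cong ≈-refl
  (value-extend t p (λ i q → h (suc i) (ℕ.s≤s q))))

-- Evaluation of a list of coefficients that vanish from index N on.
eval-value : ∀ N p t → (∀ i → N ℕ.≤ i → coeff p i ≈ 0ℝ) →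
             eval p (fromℚ t) ≈ value N (coeff p) t
eval-value N       []      t h = ≈-sym (value-zero N t (λ _ → ≈-refl))
eval-value zero    (a ∷ p) t h = ≈-trans
  (+-cong (h 0 ℕ.z≤n) (*-cong ≈-refl (eval-value 0 p t (λ i _ → h (suc i) ℕ.z≤n))))
  (≈-trans (0+ _) (zeroʳ (fromℚ t)))
eval-value (suc N) (a ∷ p) t h =
  +-cong ≈-refl (*-cong ≈-refl (eval-value N p t (λ i q → h (suc i) (ℕ.s≤s q))))

value-parity : ∀ M c t → value (M ℕ.* 2) c t ≈
  value M (λ a → c (a ℕ.* 2)) (t ℚ.* t) + fromℚ t * value M (λ a → c (suc (a ℕ.* 2))) (t ℚ.* t)
value-parity zero    c t = ≈-sym (≈-trans (0+ _) (zeroʳ (fromℚ t)))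
value-parity (suc M) c t = ≈-trans
  (+-cong ≈-refl (*-cong ≈-refl (+-cong ≈-refl (*-cong ≈-refl
    (value-parity M (λ i → c (suc (suc i))) t)))))
  (termwise⇒≈ λ m → regroup (seq (c 0) m) (seq (c 1) m) t (seq ev m) (seq od m))
  where
  ev od : ℝ
  ev = value M (λ a → c (suc (suc (a ℕ.* 2)))) (t ℚ.* t)
  od = value M (λ a → c (suc (suc (suc (a ℕ.* 2))))) (t ℚ.* t)
  regroup : ∀ a b t u v →
    a ℚ.+ t ℚ.* (b ℚ.+ t ℚ.* (u ℚ.+ t ℚ.* v)) ≡
    (a ℚ.+ (t ℚ.* t) ℚ.* u) ℚ.+ t ℚ.* (b ℚ.+ (t ℚ.* t) ℚ.* v)
  regroup = solve 5 (λ a b t u v → a :+ t :* (b :+ t :* (u :+ t :* v)) :=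
                       (a :+ (t :* t) :* u) :+ t :* (b :+ (t :* t) :* v)) refl

-- The sign (-1)^k.
sg : ℕ → ℚ
sg zero    = 1ℚ
sg (suc k) = ℚ.- sg k

sg-+ : ∀ j k → sg (j ℕ.+ k) ≡ sg j ℚ.* sg k
sg-+ zero    k = sym (ℚ.*-identityˡ (sg k))
sg-+ (suc j) k = trans (cong ℚ.-_ (sg-+ j k)) (ℚ.neg-distribˡ-* (sg j) (sg k))

-- The coefficients of z p(z).
shift : (ℕ → ℝ) → ℕ → ℝ
shift p zero    = 0ℝ
shift p (suc a) = p a

-- The coefficients of (z - v) p(z).
timesLinear : ℚ → (ℕ → ℝ) → ℕ → ℝ
timesLinear v p a = shift p a + fromℚ (ℚ.- v) * p a

value-shift : ∀ N p t → value (suc N) (shift p) t ≈ fromℚ t * value N p t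
value-shift N p t = 0+ (fromℚ t * value N p t)

value-timesLinear : ∀ N v p t → (∀ i → N ℕ.≤ i → p i ≈ 0ℝ) →
  value (suc N) (timesLinear v p) t ≈ fromℚ (t ℚ.- v) * value N p t
value-timesLinear N v p t h = begin
  value (suc N) (timesLinear v p) t
    ≈⟨ value-linear (suc N) (shift p) (fromℚ (ℚ.- v)) p t ⟩
  value (suc N) (shift p) t + fromℚ (ℚ.- v) * value (suc N) p t
    ≈⟨ +-cong (value-shift N p t) (*-cong ≈-refl (value-extend t (ℕ.n≤1+n N) h)) ⟩
  fromℚ t * value N p t + fromℚ (ℚ.- v) * value N p t
    ≈⟨ termwise⇒≈ (λ m → sym (ℚ.*-distribʳ-+ (seq (value N p t) m) t (ℚ.- v))) ⟩
  fromℚ (t ℚ.- v) * value N p t ∎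

-- The coefficients of the product of the factors z - u j with j < m.
nodal : ℕ → (ℕ → ℚ) → ℕ → ℝ
nodal zero    u zero    = 1ℝ
nodal zero    u (suc a) = 0ℝ
nodal (suc m) u a = timesLinear (u 0) (nodal m (λ j → u (suc j))) a

timesLinear-zero : ∀ v p a → shift p a ≈ 0ℝ → p a ≈ 0ℝ → timesLinear v p a ≈ 0ℝ
timesLinear-zero v p a h k =
  ≈-trans (+-cong h (*-cong ≈-refl k)) (≈-trans (0+ _) (zeroʳ (fromℚ (ℚ.- v))))

nodal-higher : ∀ m u a → m ℕ.< a → nodal m u a ≈ 0ℝ
nodal-higher zero    u (suc a) _         = ≈-refl
nodal-higher (suc m) u (suc a) (ℕ.s≤s p) =
  timesLinear-zero (u 0) (nodal m (λ j → u (suc j))) (suc a)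
    (nodal-higher m (λ j → u (suc j)) a p)
    (nodal-higher m (λ j → u (suc j)) (suc a) (ℕ.m≤n⇒m≤1+n p))

timesLinear-monic : ∀ m v p → p m ≈ 1ℝ → p (suc m) ≈ 0ℝ → timesLinear v p (suc m) ≈ 1ℝ
timesLinear-monic m v p h k =
  ≈-trans (+-cong h (≈-trans (*-cong ≈-refl k) (zeroʳ (fromℚ (ℚ.- v))))) (+0 1ℝ)

nodal-monic : ∀ m u → nodal m u m ≈ 1ℝ
nodal-monic zero    u = ≈-refl
nodal-monic (suc m) u = timesLinear-monic m (u 0) (nodal m (λ j → u (suc j)))
  (nodal-monic m (λ j → u (suc j))) (nodal-higher m (λ j → u (suc j)) (suc m) ℕ.≤-refl)

zero-at-root : ∀ v x → fromℚ (v ℚ.- v) * x ≈ 0ℝ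
zero-at-root v x = termwise⇒≈ λ m → subst (λ t → t ℚ.* seq x m ≡ 0ℚ)
  (sym (ℚ.+-inverseʳ v)) (ℚ.*-zeroˡ (seq x m))

nodal-root : ∀ m u k → k ℕ.< m → value (suc m) (nodal m u) (u k) ≈ 0ℝ
nodal-root (suc m) u zero    _         = ≈-trans
  (value-timesLinear (suc m) (u 0) (nodal m (λ j → u (suc j))) (u 0)
    (nodal-higher m (λ j → u (suc j))))
  (zero-at-root (u 0) _)
nodal-root (suc m) u (suc k) (ℕ.s≤s p) = ≈-trans
  (value-timesLinear (suc m) (u 0) (nodal m (λ j → u (suc j))) (u (suc k))
    (nodal-higher m (λ j → u (suc j))))
  (≈-trans (*-cong ≈-refl (nodal-root m (λ j → u (suc j)) k p)) (zeroʳ _))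

-- The coefficients of q minus the multiple of p that cancels the coefficient of
-- z^N when p is monic of degree N.
cancelTop : ℕ → (ℕ → ℝ) → (ℕ → ℝ) → ℕ → ℝ
cancelTop N q p a = q a + (- q N) * p a

cancelTop-top : ∀ N q p → p N ≈ 1ℝ → cancelTop N q p N ≈ 0ℝ
cancelTop-top N q p h = ≈-trans (+-cong ≈-refl (*-cong ≈-refl h))
  (termwise⇒≈ λ m → cancel (seq (q N) m))
  where
  cancel : ∀ x → x ℚ.+ (ℚ.- x) ℚ.* 1ℚ ≡ 0ℚ
  cancel = solve 1 (λ x → x :+ (:- x) :* con 1ℚ := con 0ℚ) refl

value-snoc : ∀ N {c} t → c N ≈ 0ℝ → value (suc N) c t ≈ value N c t
value-snoc zero    t h = ≈-trans (+-cong h (zeroʳ (fromℚ t))) (0+ 0ℝ)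
value-snoc (suc N) t h = +-cong ≈-refl (*-cong ≈-refl (value-snoc N t h))

-- Thus q - q_N p has degree below N and agrees with q at the roots of p: it
-- interpolates q there.
value-cancelTop : ∀ N q p t → p N ≈ 1ℝ → value (suc N) p t ≈ 0ℝ →
  value N (cancelTop N q p) t ≈ value (suc N) q t
value-cancelTop N q p t monic root = begin
  value N (cancelTop N q p) t
    ≈⟨ ≈-sym (value-snoc N t (cancelTop-top N q p monic)) ⟩
  value (suc N) (cancelTop N q p) t
    ≈⟨ value-linear (suc N) q (- q N) p t ⟩
  value (suc N) q t + (- q N) * value (suc N) p t
    ≈⟨ +-cong ≈-refl (≈-trans (*-cong ≈-refl root) (zeroʳ (- q N))) ⟩
  value (suc N) q t + 0ℝ
    ≈⟨ +0 (value (suc N) q t) ⟩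
  value (suc N) q t ∎

shift-linear : ∀ c k c′ a →
  shift (λ i → c i + k * c′ i) a ≈ shift c a + k * shift c′ a
shift-linear c k c′ zero    = ≈-sym (≈-trans (0+ (k * 0ℝ)) (zeroʳ k))
shift-linear c k c′ (suc a) = ≈-refl

-- If the roots of p are the inner nodes, A interpolates q at these and at v, and
-- D at these and at w.  This is Neville's identity
-- (v - w) q = (z - w) A - (z - v) D, read off at the coefficient of z^a.
neville : ∀ v w p q N a →
  let A = cancelTop N q (timesLinear v p)
      D = cancelTop N q (timesLinear w p)
  in fromℚ (v ℚ.- w) * q a ≈
     (shift A a + fromℚ (ℚ.- w) * A a) - (shift D a + fromℚ (ℚ.- v) * D a)
neville v w p q N a = ≈-sym (≈-trans
  (+-cong (+-cong (shifted v) ≈-refl) (-‿cong (+-cong (shifted w) ≈-refl)))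
  (termwise⇒≈ λ m → expand v w (seq (q N) m) (seq (shift q a) m) (seq (q a) m)
    (seq (shift (shift p) a) m) (seq (shift p a) m) (seq (p a) m)))
  where
  shifted : ∀ v → shift (cancelTop N q (timesLinear v p)) a ≈
    shift q a + (- q N) * (shift (shift p) a + fromℚ (ℚ.- v) * shift p a)
  shifted v = ≈-trans (shift-linear q (- q N) (timesLinear v p) a)
    (+-cong ≈-refl (*-cong ≈-refl (shift-linear (shift p) (fromℚ (ℚ.- v)) p a)))
  expand : ∀ v w l q′ q x y z →
    ((q′ ℚ.+ (ℚ.- l) ℚ.* (x ℚ.+ (ℚ.- v) ℚ.* y)) ℚ.+
       (ℚ.- w) ℚ.* (q ℚ.+ (ℚ.- l) ℚ.* (y ℚ.+ (ℚ.- v) ℚ.* z))) ℚ.+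
    (ℚ.- ((q′ ℚ.+ (ℚ.- l) ℚ.* (x ℚ.+ (ℚ.- w) ℚ.* y)) ℚ.+
       (ℚ.- v) ℚ.* (q ℚ.+ (ℚ.- l) ℚ.* (y ℚ.+ (ℚ.- w) ℚ.* z)))) ≡ (v ℚ.- w) ℚ.* q
  expand = solve 8 (λ v w l q′ q x y z →
    ((q′ :+ (:- l) :* (x :+ (:- v) :* y)) :+
       (:- w) :* (q :+ (:- l) :* (y :+ (:- v) :* z))) :+
    (:- ((q′ :+ (:- l) :* (x :+ (:- w) :* y)) :+
       (:- v) :* (q :+ (:- l) :* (y :+ (:- w) :* z)))) := (v :- w) :* q) refl

neg-involutive : ∀ p → ℚ.- (ℚ.- p) ≡ p
neg-involutive = solve 1 (λ p → :- (:- p) := p) refl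

-- The sign (-1)^(m+a) belongs to a polynomial of degree m: its leading
-- coefficient a = m gets the sign s.  Multiplication by z raises m and a by one.
alternating-shift : ∀ m s (c : ℕ → ℝ) → (∀ a → a ℕ.≤ m → 0ℝ ≤ fromℚ (s ℚ.* sg (m ℕ.+ a)) * c a) →
  ∀ a → a ℕ.≤ suc m → 0ℝ ≤ fromℚ (s ℚ.* sg (suc m ℕ.+ a)) * shift c a
alternating-shift m s c h zero    _         =
  ≤-reflexive (≈-sym (zeroʳ (fromℚ (s ℚ.* sg (suc m ℕ.+ 0)))))
alternating-shift m s c h (suc a) (ℕ.s≤s p) =
  subst (λ t → 0ℝ ≤ fromℚ (s ℚ.* t) * c a) sign-eq (h a p)
  where
  sign-eq : sg (m ℕ.+ a) ≡ sg (suc m ℕ.+ suc a)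
  sign-eq = trans (sym (neg-involutive (sg (m ℕ.+ a))))
                  (cong (λ j → ℚ.- sg j) (sym (ℕ.+-suc m a)))

-- The coefficient at the cancelled position satisfies any sign condition.
alternating-extend : ∀ m s (c : ℕ → ℝ) → c (suc m) ≈ 0ℝ →
  (∀ a → a ℕ.≤ m → 0ℝ ≤ fromℚ (s ℚ.* sg (m ℕ.+ a)) * c a) →
  ∀ a → a ℕ.≤ suc m → 0ℝ ≤ fromℚ (s ℚ.* sg (m ℕ.+ a)) * c a
alternating-extend m s c top h a p with ℕ.m≤n⇒m<n∨m≡n p
... | inj₁ (ℕ.s≤s a≤m) = h a a≤m
... | inj₂ refl        = ≤-reflexive (≈-sym (*-zero (fromℚ (s ℚ.* sg (m ℕ.+ suc m))) top))

-- Neville's identity multiplied by s (-1)^(m+1+a), where τ stands for (-1)^(m+a).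
-- The sign s is attached to A and the sign - s to D, so that each summand is
-- nonnegative when A and D alternate.
neville-signed : ∀ v w s τ p q N a →
  let A = cancelTop N q (timesLinear v p)
      D = cancelTop N q (timesLinear w p)
  in fromℚ (v ℚ.- w) * (fromℚ (s ℚ.* (ℚ.- τ)) * q a) ≈
     ((fromℚ (s ℚ.* (ℚ.- τ)) * shift A a + fromℚ w * (fromℚ (s ℚ.* τ) * A a)) +
      fromℚ ((ℚ.- s) ℚ.* (ℚ.- τ)) * shift D a) + fromℚ v * (fromℚ ((ℚ.- s) ℚ.* τ) * D a)
neville-signed v w s τ p q N a = begin
  fromℚ (v ℚ.- w) * (fromℚ (s ℚ.* (ℚ.- τ)) * q a)
    ≈⟨ termwise⇒≈ (λ i → swap (v ℚ.- w) (s ℚ.* (ℚ.- τ)) (seq (q a) i)) ⟩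
  fromℚ (s ℚ.* (ℚ.- τ)) * (fromℚ (v ℚ.- w) * q a)
    ≈⟨ *-cong (≈-refl {fromℚ (s ℚ.* (ℚ.- τ))}) (neville v w p q N a) ⟩
  fromℚ (s ℚ.* (ℚ.- τ)) * ((shift A a + fromℚ (ℚ.- w) * A a) - (shift D a + fromℚ (ℚ.- v) * D a))
    ≈⟨ termwise⇒≈ (λ i → distribute v w s τ (seq (shift A a) i) (seq (A a) i)
                                            (seq (shift D a) i) (seq (D a) i)) ⟩
  ((fromℚ (s ℚ.* (ℚ.- τ)) * shift A a + fromℚ w * (fromℚ (s ℚ.* τ) * A a)) +
   fromℚ ((ℚ.- s) ℚ.* (ℚ.- τ)) * shift D a) + fromℚ v * (fromℚ ((ℚ.- s) ℚ.* τ) * D a) ∎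
  where
  A D : ℕ → ℝ
  A = cancelTop N q (timesLinear v p)
  D = cancelTop N q (timesLinear w p)
  swap : ∀ c s q → c ℚ.* (s ℚ.* q) ≡ s ℚ.* (c ℚ.* q)
  swap = solve 3 (λ c s q → c :* (s :* q) := s :* (c :* q)) refl
  distribute : ∀ v w s τ A′ A D′ D →
    (s ℚ.* (ℚ.- τ)) ℚ.* ((A′ ℚ.+ (ℚ.- w) ℚ.* A) ℚ.+ (ℚ.- (D′ ℚ.+ (ℚ.- v) ℚ.* D))) ≡
    (((s ℚ.* (ℚ.- τ)) ℚ.* A′ ℚ.+ w ℚ.* ((s ℚ.* τ) ℚ.* A)) ℚ.+
     ((ℚ.- s) ℚ.* (ℚ.- τ)) ℚ.* D′) ℚ.+ v ℚ.* (((ℚ.- s) ℚ.* τ) ℚ.* D)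
  distribute = solve 8 (λ v w s τ A′ A D′ D →
    (s :* (:- τ)) :* ((A′ :+ (:- w) :* A) :+ (:- (D′ :+ (:- v) :* D))) :=
    (((s :* (:- τ)) :* A′ :+ w :* ((s :* τ) :* A)) :+
     ((:- s) :* (:- τ)) :* D′) :+ v :* (((:- s) :* τ) :* D)) refl

-s*sg : ∀ s t → s ℚ.* (ℚ.- t) ≡ (ℚ.- s) ℚ.* t
-s*sg = solve 2 (λ s t → s :* (:- t) := (:- s) :* t) refl

neville-nonneg : ∀ m s v w p q a → 0ℚ ℚ.< v → 0ℚ ℚ.< w → w ℚ.< v →
  let A = cancelTop (suc m) q (timesLinear v p)
      D = cancelTop (suc m) q (timesLinear w p)
      τ = sg (m ℕ.+ a)
  in 0ℝ ≤ fromℚ (s ℚ.* (ℚ.- τ)) * shift A a → 0ℝ ≤ fromℚ (s ℚ.* τ) * A a →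
     0ℝ ≤ fromℚ ((ℚ.- s) ℚ.* (ℚ.- τ)) * shift D a → 0ℝ ≤ fromℚ ((ℚ.- s) ℚ.* τ) * D a →
     0ℝ ≤ fromℚ (s ℚ.* (ℚ.- τ)) * q a
neville-nonneg m s v w p q a 0<v 0<w w<v A′≥ A≥ D′≥ D≥ =
  0≤-unscale {v ℚ.- w} {fromℚ (s ℚ.* (ℚ.- sg (m ℕ.+ a))) * q a} (0<q-p {w} {v} w<v)
    (0≤-cong (≈-sym (neville-signed v w s (sg (m ℕ.+ a)) p q (suc m) a)) sum≥)
  where
  A D : ℕ → ℝ
  A = cancelTop (suc m) q (timesLinear v p)
  D = cancelTop (suc m) q (timesLinear w p)
  τ : ℚ
  τ = sg (m ℕ.+ a)
  x₁ x₂ x₃ x₄ : ℝ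
  x₁ = fromℚ (s ℚ.* (ℚ.- τ)) * shift A a
  x₂ = fromℚ w * (fromℚ (s ℚ.* τ) * A a)
  x₃ = fromℚ ((ℚ.- s) ℚ.* (ℚ.- τ)) * shift D a
  x₄ = fromℚ v * (fromℚ ((ℚ.- s) ℚ.* τ) * D a)
  x₂≥ : 0ℝ ≤ x₂
  x₂≥ = 0≤-scale {w} {fromℚ (s ℚ.* τ) * A a} (ℚ.<⇒≤ 0<w) A≥
  x₄≥ : 0ℝ ≤ x₄
  x₄≥ = 0≤-scale {v} {fromℚ ((ℚ.- s) ℚ.* τ) * D a} (ℚ.<⇒≤ 0<v) D≥
  sum≥ : 0ℝ ≤ ((x₁ + x₂) + x₃) + x₄
  sum≥ = 0≤-+ {(x₁ + x₂) + x₃} {x₄} (0≤-+ {x₁ + x₂} {x₃} (0≤-+ {x₁} {x₂} A′≥ x₂≥) D′≥) x₄≥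

0≤-scale-cong : ∀ r x y → x ≈ y → 0ℝ ≤ fromℚ r * x → 0ℝ ≤ fromℚ r * y
0≤-scale-cong r x y x≈y = 0≤-cong {fromℚ r * x} {fromℚ r * y} (*-cong (≈-refl {fromℚ r}) x≈y)

value-1 : ∀ c t → value 1 c t ≈ c 0
value-1 c t = ≈-trans (+-cong (≈-refl {c 0}) (zeroʳ (fromℚ t))) (+0 (c 0))

-- A polynomial of degree at most m whose values at m + 1 decreasing positive
-- points alternate in sign has coefficients that alternate in sign.  The sign s
-- of the first value is a parameter, since the induction uses the statement for
-- A with s and, starting from the second point, for D with - s.
alternating-coefficients : ∀ m s u →
  (∀ k → k ℕ.≤ m → 0ℚ ℚ.< u k) → (∀ k → k ℕ.< m → u (suc k) ℚ.< u k) →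
  ∀ q → (∀ k → k ℕ.≤ m → 0ℝ ≤ fromℚ (s ℚ.* sg k) * value (suc m) q (u k)) →
  ∀ a → a ℕ.≤ m → 0ℝ ≤ fromℚ (s ℚ.* sg (m ℕ.+ a)) * q a
alternating-coefficients zero s u pos dec q h zero _ =
  0≤-scale-cong (s ℚ.* 1ℚ) (value 1 q (u 0)) (q 0) (value-1 q (u 0)) (h 0 ℕ.z≤n)
alternating-coefficients (suc m) s u pos dec q h a a≤ =
  neville-nonneg m s v w p q a (pos 0 ℕ.z≤n) (pos (suc m) ℕ.≤-refl) w<v
    (alternating-shift m s A A-alt a a≤) (A-alt′ a a≤)
    (alternating-shift m (ℚ.- s) D D-alt a a≤) (D-alt′ a a≤)
  where
  v w : ℚ
  v = u 0
  w = u (suc m)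
  u′ : ℕ → ℚ
  u′ k = u (suc k)
  p A D : ℕ → ℝ
  p = nodal m u′
  A = cancelTop (suc m) q (timesLinear v p)
  D = cancelTop (suc m) q (timesLinear w p)

  below-first : ∀ k → k ℕ.≤ m → u (suc k) ℚ.< u 0
  below-first zero    k≤ = dec 0 (ℕ.s≤s ℕ.z≤n)
  below-first (suc k) k≤ = ℚ.<-trans (dec (suc k) (ℕ.s≤s k≤)) (below-first k (ℕ.<⇒≤ k≤))
  w<v : w ℚ.< v
  w<v = below-first m ℕ.≤-refl

  monic : ∀ v → timesLinear v p (suc m) ≈ 1ℝ
  monic v = timesLinear-monic m v p (nodal-monic m u′) (nodal-higher m u′ (suc m) ℕ.≤-refl)

  D-root : ∀ k → k ℕ.≤ m → value (suc (suc m)) (timesLinear w p) (u′ k) ≈ 0ℝ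
  D-root k k≤m = ≈-trans (value-timesLinear (suc m) w p (u′ k) (nodal-higher m u′))
    ([ (λ k<m → *-zero (fromℚ (u′ k ℚ.- w)) (nodal-root m u′ k k<m))
     , (λ k≡m → subst (λ i → fromℚ (u′ k ℚ.- u′ i) * value (suc m) p (u′ k) ≈ 0ℝ) k≡m
                  (zero-at-root (u′ k) (value (suc m) p (u′ k)))) ]′
     (ℕ.m≤n⇒m<n∨m≡n k≤m))

  A-alt : ∀ a → a ℕ.≤ m → 0ℝ ≤ fromℚ (s ℚ.* sg (m ℕ.+ a)) * A a
  A-alt = alternating-coefficients m s u (λ k k≤ → pos k (ℕ.m≤n⇒m≤1+n k≤))
    (λ k k< → dec k (ℕ.m≤n⇒m≤1+n k<)) A
    (λ k k≤ → 0≤-scale-cong (s ℚ.* sg k) (value (suc (suc m)) q (u k)) (value (suc m) A (u k))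
      (≈-sym (value-cancelTop (suc m) q (timesLinear v p) (u k) (monic v)
               (nodal-root (suc m) u k (ℕ.s≤s k≤))))
      (h k (ℕ.m≤n⇒m≤1+n k≤)))
  D-alt : ∀ a → a ℕ.≤ m → 0ℝ ≤ fromℚ ((ℚ.- s) ℚ.* sg (m ℕ.+ a)) * D a
  D-alt = alternating-coefficients m (ℚ.- s) u′ (λ k k≤ → pos (suc k) (ℕ.s≤s k≤))
    (λ k k< → dec (suc k) (ℕ.s≤s k<)) D
    (λ k k≤ → 0≤-scale-cong ((ℚ.- s) ℚ.* sg k)
      (value (suc (suc m)) q (u′ k)) (value (suc m) D (u′ k))
      (≈-sym (value-cancelTop (suc m) q (timesLinear w p) (u′ k) (monic w) (D-root k k≤)))
      (subst (λ t → 0ℝ ≤ fromℚ t * value (suc (suc m)) q (u′ k)) (-s*sg s (sg k))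
        (h (suc k) (ℕ.s≤s k≤))))
  A-alt′ : ∀ a → a ℕ.≤ suc m → 0ℝ ≤ fromℚ (s ℚ.* sg (m ℕ.+ a)) * A a
  A-alt′ = alternating-extend m s A (cancelTop-top (suc m) q (timesLinear v p) (monic v)) A-alt
  D-alt′ : ∀ a → a ℕ.≤ suc m → 0ℝ ≤ fromℚ ((ℚ.- s) ℚ.* sg (m ℕ.+ a)) * D a
  D-alt′ = alternating-extend m (ℚ.- s) D
             (cancelTop-top (suc m) q (timesLinear w p) (monic w)) D-alt

-- Rational rotations

-- The point with coordinates c and s lies on the unit circle.
OnCircle : ℚ → ℚ → Set
OnCircle c s = c ℚ.* c ℚ.+ s ℚ.* s ≡ 1ℚ

-- Cosine and sine of the k-fold multiple of the angle with cosine c and sine s.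
cosine sine : ℚ → ℚ → ℕ → ℚ
cosine c s zero    = 1ℚ
cosine c s (suc k) = c ℚ.* cosine c s k ℚ.- s ℚ.* sine c s k
sine   c s zero    = 0ℚ
sine   c s (suc k) = s ℚ.* cosine c s k ℚ.+ c ℚ.* sine c s k

sine-1 : ∀ c s → sine c s 1 ≡ s
sine-1 = solve 2 (λ c s → s :* con 1ℚ :+ c :* con 0ℚ := s) refl

cosine-+ : ∀ c s j k → cosine c s (j ℕ.+ k) ≡
           cosine c s j ℚ.* cosine c s k ℚ.- sine c s j ℚ.* sine c s k
sine-+ : ∀ c s j k → sine c s (j ℕ.+ k) ≡
         sine c s j ℚ.* cosine c s k ℚ.+ cosine c s j ℚ.* sine c s k
cosine-+ c s zero k = unit (cosine c s k) (sine c s k)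
  where
  unit : ∀ x y → x ≡ 1ℚ ℚ.* x ℚ.- 0ℚ ℚ.* y
  unit = solve 2 (λ x y → x := con 1ℚ :* x :- con 0ℚ :* y) refl
cosine-+ c s (suc j) k = trans
  (cong₂ (λ x y → c ℚ.* x ℚ.- s ℚ.* y) (cosine-+ c s j k) (sine-+ c s j k))
  (assoc c s (cosine c s j) (sine c s j) (cosine c s k) (sine c s k))
  where
  assoc : ∀ c s x y z w → c ℚ.* (x ℚ.* z ℚ.- y ℚ.* w) ℚ.- s ℚ.* (y ℚ.* z ℚ.+ x ℚ.* w) ≡
          (c ℚ.* x ℚ.- s ℚ.* y) ℚ.* z ℚ.- (s ℚ.* x ℚ.+ c ℚ.* y) ℚ.* w
  assoc = solve 6 (λ c s x y z w → c :* (x :* z :- y :* w) :- s :* (y :* z :+ x :* w) :=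
          (c :* x :- s :* y) :* z :- (s :* x :+ c :* y) :* w) refl
sine-+ c s zero k = unit (cosine c s k) (sine c s k)
  where
  unit : ∀ x y → y ≡ 0ℚ ℚ.* x ℚ.+ 1ℚ ℚ.* y
  unit = solve 2 (λ x y → y := con 0ℚ :* x :+ con 1ℚ :* y) refl
sine-+ c s (suc j) k = trans
  (cong₂ (λ x y → s ℚ.* x ℚ.+ c ℚ.* y) (cosine-+ c s j k) (sine-+ c s j k))
  (assoc c s (cosine c s j) (sine c s j) (cosine c s k) (sine c s k))
  where
  assoc : ∀ c s x y z w → s ℚ.* (x ℚ.* z ℚ.- y ℚ.* w) ℚ.+ c ℚ.* (y ℚ.* z ℚ.+ x ℚ.* w) ≡
          (s ℚ.* x ℚ.+ c ℚ.* y) ℚ.* z ℚ.+ (c ℚ.* x ℚ.- s ℚ.* y) ℚ.* w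
  assoc = solve 6 (λ c s x y z w → s :* (x :* z :- y :* w) :+ c :* (y :* z :+ x :* w) :=
          (s :* x :+ c :* y) :* z :+ (c :* x :- s :* y) :* w) refl

cosine-* : ∀ c s M k → cosine (cosine c s M) (sine c s M) k ≡ cosine c s (k ℕ.* M)
sine-*   : ∀ c s M k → sine (cosine c s M) (sine c s M) k ≡ sine c s (k ℕ.* M)
cosine-* c s M zero    = refl
cosine-* c s M (suc k) = trans
  (cong₂ (λ x y → cosine c s M ℚ.* x ℚ.- sine c s M ℚ.* y) (cosine-* c s M k) (sine-* c s M k))
  (sym (cosine-+ c s M (k ℕ.* M)))
sine-* c s M zero    = refl
sine-* c s M (suc k) = trans
  (cong₂ (λ x y → sine c s M ℚ.* x ℚ.+ cosine c s M ℚ.* y) (cosine-* c s M k) (sine-* c s M k))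
  (sym (sine-+ c s M (k ℕ.* M)))

-- The negated point is the angle plus a half turn.
cosine-neg : ∀ c s k → cosine (ℚ.- c) (ℚ.- s) k ≡ sg k ℚ.* cosine c s k
sine-neg   : ∀ c s k → sine (ℚ.- c) (ℚ.- s) k ≡ sg k ℚ.* sine c s k
cosine-neg c s zero    = refl
cosine-neg c s (suc k) = trans
  (cong₂ (λ x y → (ℚ.- c) ℚ.* x ℚ.- (ℚ.- s) ℚ.* y) (cosine-neg c s k) (sine-neg c s k))
  (factor c s (sg k) (cosine c s k) (sine c s k))
  where
  factor : ∀ c s t x y → (ℚ.- c) ℚ.* (t ℚ.* x) ℚ.- (ℚ.- s) ℚ.* (t ℚ.* y) ≡
                         (ℚ.- t) ℚ.* (c ℚ.* x ℚ.- s ℚ.* y)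
  factor = solve 5 (λ c s t x y → (:- c) :* (t :* x) :- (:- s) :* (t :* y) :=
                                  (:- t) :* (c :* x :- s :* y)) refl
sine-neg c s zero    = refl
sine-neg c s (suc k) = trans
  (cong₂ (λ x y → (ℚ.- s) ℚ.* x ℚ.+ (ℚ.- c) ℚ.* y) (cosine-neg c s k) (sine-neg c s k))
  (factor c s (sg k) (cosine c s k) (sine c s k))
  where
  factor : ∀ c s t x y → (ℚ.- s) ℚ.* (t ℚ.* x) ℚ.+ (ℚ.- c) ℚ.* (t ℚ.* y) ≡
                         (ℚ.- t) ℚ.* (s ℚ.* x ℚ.+ c ℚ.* y)
  factor = solve 5 (λ c s t x y → (:- s) :* (t :* x) :+ (:- c) :* (t :* y) :=
                                  (:- t) :* (s :* x :+ c :* y)) refl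

onCircle-neg : ∀ c s → OnCircle c s → OnCircle (ℚ.- c) (ℚ.- s)
onCircle-neg c s unit = trans (cong₂ ℚ._+_ (neg*neg c) (neg*neg s)) unit

lagrange : ∀ a b x y →
  (a ℚ.* x ℚ.- b ℚ.* y) ℚ.* (a ℚ.* x ℚ.- b ℚ.* y) ℚ.+
  (b ℚ.* x ℚ.+ a ℚ.* y) ℚ.* (b ℚ.* x ℚ.+ a ℚ.* y) ≡
  (a ℚ.* a ℚ.+ b ℚ.* b) ℚ.* (x ℚ.* x ℚ.+ y ℚ.* y)
lagrange = solve 4 (λ a b x y →
  (a :* x :- b :* y) :* (a :* x :- b :* y) :+ (b :* x :+ a :* y) :* (b :* x :+ a :* y) :=
  (a :* a :+ b :* b) :* (x :* x :+ y :* y)) refl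

onCircle-multiple : ∀ c s → OnCircle c s → ∀ k → OnCircle (cosine c s k) (sine c s k)
onCircle-multiple c s unit zero    = refl
onCircle-multiple c s unit (suc k) = trans (lagrange c s (cosine c s k) (sine c s k))
  (trans (cong₂ ℚ._*_ unit (onCircle-multiple c s unit k)) (ℚ.*-identityˡ 1ℚ))

∣p∣≤1 : ∀ p → p ℚ.* p ℚ.≤ 1ℚ → ℚ.∣ p ∣ ℚ.≤ 1ℚ
∣p∣≤1 p p²≤1 = ℚ.≮⇒≥ λ 1<∣p∣ → ℚ.<-irrefl refl
  (ℚ.<-≤-trans (ℚ.<-trans 1<∣p∣ (grow 1<∣p∣)) (subst (ℚ._≤ 1ℚ) (sym square) p²≤1))
  where
  grow : 1ℚ ℚ.< ℚ.∣ p ∣ → ℚ.∣ p ∣ ℚ.< ℚ.∣ p ∣ ℚ.* ℚ.∣ p ∣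
  grow 1<∣p∣ = subst (ℚ._< ℚ.∣ p ∣ ℚ.* ℚ.∣ p ∣) (ℚ.*-identityʳ ℚ.∣ p ∣)
    (ℚ.*-monoʳ-<-pos ℚ.∣ p ∣ {{ℚ.positive (ℚ.<-trans 0<1 1<∣p∣)}} 1<∣p∣)
  square : ℚ.∣ p ∣ ℚ.* ℚ.∣ p ∣ ≡ p ℚ.* p
  square = trans (sym (ℚ.∣p*q∣≡∣p∣*∣q∣ p p)) (ℚ.0≤p⇒∣p∣≡p (0≤p*p p))

p≤p+q : ∀ p q → 0ℚ ℚ.≤ q → p ℚ.≤ p ℚ.+ q
p≤p+q p q 0≤q = subst (ℚ._≤ p ℚ.+ q) (ℚ.+-identityʳ p) (ℚ.+-monoʳ-≤ p 0≤q)

∣cos∣≤1 : ∀ c s → OnCircle c s → ℚ.∣ c ∣ ℚ.≤ 1ℚ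
∣cos∣≤1 c s unit = ∣p∣≤1 c (subst (c ℚ.* c ℚ.≤_) unit (p≤p+q (c ℚ.* c) (s ℚ.* s) (0≤p*p s)))

∣sin∣≤1 : ∀ c s → OnCircle c s → ℚ.∣ s ∣ ℚ.≤ 1ℚ
∣sin∣≤1 c s unit = ∣p∣≤1 s (subst (s ℚ.* s ℚ.≤_) (trans (ℚ.+-comm (s ℚ.* s) (c ℚ.* c)) unit)
  (p≤p+q (s ℚ.* s) (c ℚ.* c) (0≤p*p c)))

-- A rational point of the circle as a real angle; its multiples are computed by
-- cosine and sine.
rational-angle : ∀ c s → OnCircle c s → Angle
rational-angle c s unit = record
  { cos = fromℚ c ; sin = fromℚ s ; onCircle = termwise⇒≈ λ _ → unit }

cos-multiple : ∀ c s (unit : OnCircle c s) k m →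
  seq (cos (k · rational-angle c s unit)) m ≡ cosine c s k
sin-multiple : ∀ c s (unit : OnCircle c s) k m →
  seq (sin (k · rational-angle c s unit)) m ≡ sine c s k
cos-multiple c s unit zero    m = refl
cos-multiple c s unit (suc k) m = cong₂ (λ x y → c ℚ.* x ℚ.- s ℚ.* y)
  (cos-multiple c s unit k m) (sin-multiple c s unit k m)
sin-multiple c s unit zero    m = refl
sin-multiple c s unit (suc k) m = cong₂ (λ x y → s ℚ.* x ℚ.+ c ℚ.* y)
  (cos-multiple c s unit k m) (sin-multiple c s unit k m)

-- Natural numbers as rationals.
ι : ℕ → ℚ
ι zero    = 0ℚ
ι (suc k) = 1ℚ ℚ.+ ι k

ι≥0 : ∀ k → 0ℚ ℚ.≤ ι k
ι≥0 zero    = ℚ.≤-refl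
ι≥0 (suc k) = 0≤+ (ℚ.<⇒≤ 0<1) (ι≥0 k)

step-difference : ∀ c s x y →
  (1ℚ ℚ.- c) ℚ.* x ℚ.+ s ℚ.* y ≡ x ℚ.- (c ℚ.* x ℚ.- s ℚ.* y)
step-difference = solve 4 (λ c s x y → (con 1ℚ :- c) :* x :+ s :* y :=
                                       x :- (c :* x :- s :* y)) refl

-- One step of rotation by an angle with sine s ≥ 0 moves each coordinate by
-- at most (1 - c) + s.
step-bound : ∀ c s x y → 0ℚ ℚ.≤ 1ℚ ℚ.- c → 0ℚ ℚ.≤ s → ℚ.∣ x ∣ ℚ.≤ 1ℚ → ℚ.∣ y ∣ ℚ.≤ 1ℚ →
  ℚ.∣ (1ℚ ℚ.- c) ℚ.* x ℚ.+ s ℚ.* y ∣ ℚ.≤ (1ℚ ℚ.- c) ℚ.+ s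
step-bound c s x y 0≤1-c 0≤s x≤1 y≤1 = ℚ.≤-trans
  (ℚ.∣p+q∣≤∣p∣+∣q∣ ((1ℚ ℚ.- c) ℚ.* x) (s ℚ.* y))
  (ℚ.+-mono-≤ (term (1ℚ ℚ.- c) x 0≤1-c x≤1) (term s y 0≤s y≤1))
  where
  term : ∀ a x → 0ℚ ℚ.≤ a → ℚ.∣ x ∣ ℚ.≤ 1ℚ → ℚ.∣ a ℚ.* x ∣ ℚ.≤ a
  term a x 0≤a x≤1 = subst₂ ℚ._≤_
    (trans (cong (ℚ._* ℚ.∣ x ∣) (sym (ℚ.0≤p⇒∣p∣≡p 0≤a))) (sym (ℚ.∣p*q∣≡∣p∣*∣q∣ a x)))
    (ℚ.*-identityʳ a)
    (ℚ.*-monoˡ-≤-nonNeg a {{ℚ.nonNegative 0≤a}} x≤1)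

-- Repeated rotation by one angle, with η a bound on the change of
-- each coordinate in a step.
module Steps (c s : ℚ) (unit : OnCircle c s) (0≤1-c : 0ℚ ℚ.≤ 1ℚ ℚ.- c) (0≤s : 0ℚ ℚ.≤ s) where

  η : ℚ
  η = (1ℚ ℚ.- c) ℚ.+ s

  0≤η : 0ℚ ℚ.≤ η
  0≤η = 0≤+ 0≤1-c 0≤s

  C S : ℕ → ℚ
  C = cosine c s
  S = sine c s

  ∣C∣≤1 : ∀ k → ℚ.∣ C k ∣ ℚ.≤ 1ℚ
  ∣C∣≤1 k = ∣cos∣≤1 (C k) (S k) (onCircle-multiple c s unit k)

  ∣S∣≤1 : ∀ k → ℚ.∣ S k ∣ ℚ.≤ 1ℚ
  ∣S∣≤1 k = ∣sin∣≤1 (C k) (S k) (onCircle-multiple c s unit k)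

  cosine-step : ∀ k → ℚ.∣ C k ℚ.- C (suc k) ∣ ℚ.≤ η
  cosine-step k = subst (λ t → ℚ.∣ t ∣ ℚ.≤ η) (step-difference c s (C k) (S k))
    (step-bound c s (C k) (S k) 0≤1-c 0≤s (∣C∣≤1 k) (∣S∣≤1 k))

  sine-step : ∀ k → ℚ.∣ S k ℚ.- S (suc k) ∣ ℚ.≤ η
  sine-step k = subst (λ t → ℚ.∣ t ∣ ℚ.≤ η) (difference c s (C k) (S k))
    (step-bound c s (S k) (ℚ.- C k) 0≤1-c 0≤s (∣S∣≤1 k)
      (subst (ℚ._≤ 1ℚ) (sym (ℚ.∣-p∣≡∣p∣ (C k))) (∣C∣≤1 k)))
    where
    difference : ∀ c s x y →
      (1ℚ ℚ.- c) ℚ.* y ℚ.+ s ℚ.* (ℚ.- x) ≡ y ℚ.- (s ℚ.* x ℚ.+ c ℚ.* y)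
    difference = solve 4 (λ c s x y → (con 1ℚ :- c) :* y :+ s :* (:- x) :=
                                      y :- (s :* x :+ c :* y)) refl

  cosine-steps : ∀ j k → ℚ.∣ C k ℚ.- C (j ℕ.+ k) ∣ ℚ.≤ ι j ℚ.* η
  cosine-steps zero    k = ℚ.≤-reflexive
    (trans (cong ℚ.∣_∣ (ℚ.+-inverseʳ (C k))) (sym (ℚ.*-zeroˡ η)))
  cosine-steps (suc j) k = subst₂ ℚ._≤_
    (cong ℚ.∣_∣ (telescope (C k) (C (j ℕ.+ k)) (C (suc j ℕ.+ k))))
    (collect (ι j) η)
    (ℚ.≤-trans (ℚ.∣p+q∣≤∣p∣+∣q∣ (C k ℚ.- C (j ℕ.+ k)) (C (j ℕ.+ k) ℚ.- C (suc j ℕ.+ k)))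
      (ℚ.+-mono-≤ (cosine-steps j k) (cosine-step (j ℕ.+ k))))
    where
    telescope : ∀ x y z → (x ℚ.- y) ℚ.+ (y ℚ.- z) ≡ x ℚ.- z
    telescope = solve 3 (λ x y z → (x :- y) :+ (y :- z) := x :- z) refl
    collect : ∀ i η → i ℚ.* η ℚ.+ η ≡ (1ℚ ℚ.+ i) ℚ.* η
    collect = solve 2 (λ i η → i :* η :+ η := (con 1ℚ :+ i) :* η) refl

ι-toℚᵘ : ∀ n → ℚ.toℚᵘ (ι n) ℚᵘ.≃ ℚᵘ.mkℚᵘ (ℤ.+ n) 0
ι-toℚᵘ zero    = ℚᵘ.*≡* refl
ι-toℚᵘ (suc n) = ℚᵘ.≃-trans (ℚ.toℚᵘ-homo-+ 1ℚ (ι n))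
  (ℚᵘ.≃-trans (ℚᵘ.+-congʳ ℚᵘ.1ℚᵘ (ι-toℚᵘ n))
    (ℚᵘ.*≡* (cong (λ i → (ℤ.1ℤ ℤ.+ i) ℤ.* ℤ.1ℤ) (ℤ.*-identityʳ (ℤ.+ n)))))

archimedean : ∀ p → ∃[ n ] p ℚ.≤ ι n
archimedean p@(ℚ.mkℚ i d _) = ℤ.∣ i ∣ , ℚ.toℚᵘ-cancel-≤
  (ℚᵘ.≤-respʳ-≃ (ℚᵘ.≃-sym (ι-toℚᵘ ℤ.∣ i ∣)) (ℚᵘ.*≤* (bound i)))
  where
  bound : ∀ i → i ℤ.* ℤ.1ℤ ℤ.≤ ℤ.+ ℤ.∣ i ∣ ℤ.* ℤ.+ suc d
  bound (ℤ.+ n)      = subst₂ ℤ._≤_ (sym (ℤ.*-identityʳ (ℤ.+ n))) (ℤ.pos-* n (suc d))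
    (ℤ.+≤+ (ℕ.m≤m*n n (suc d)))
  bound (ℤ.-[1+ n ]) = subst (ℤ._≤ ℤ.+ suc n ℤ.* ℤ.+ suc d) (sym (ℤ.*-identityʳ ℤ.-[1+ n ])) ℤ.-≤+

ι-mono : ∀ {j k} → j ℕ.≤ k → ι j ℚ.≤ ι k
ι-mono {k = k} ℕ.z≤n = ι≥0 k
ι-mono (ℕ.s≤s p)     = ℚ.+-monoʳ-≤ 1ℚ (ι-mono p)

-- Least failure of a decidable property, below a bound.
first-failure : ∀ {P : ℕ → Set} → (∀ k → Dec (P k)) → ∀ B →
  (∀ j → j ℕ.< B → P j) ⊎ ∃[ k ] (∀ j → j ℕ.< k → P j) × ¬ P k
first-failure P? zero    = inj₁ λ _ ()
first-failure {P} P? (suc B) with first-failure P? B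
... | inj₂ found = inj₂ found
... | inj₁ below with P? B
...   | no ¬PB = inj₂ (B , below , ¬PB)
...   | yes PB = inj₁ λ j j<1+B → [ (λ j<B → below j j<B) , (λ j≡B → subst P (sym j≡B) PB) ]′
                                  (ℕ.m≤n⇒m<n∨m≡n (ℕ.s≤s⁻¹ j<1+B))

0≤*-cancelˡ : ∀ {p q} → 0ℚ ℚ.< p → 0ℚ ℚ.≤ p ℚ.* q → 0ℚ ℚ.≤ q
0≤*-cancelˡ {p} {q} 0<p h = ℚ.*-cancelˡ-≤-pos p {{ℚ.positive 0<p}}
  (subst (ℚ._≤ p ℚ.* q) (sym (ℚ.*-zeroʳ p)) h)

-- As long as the sines stay positive, the cotangent decreases by at least s in
-- each step, since cot φ - cot (φ + α) = sin α / (sin φ sin (φ + α)) ≥ sin α.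
-- The statement is cot ((k + 1) α) ≤ cot α - k sin α, cleared of denominators.
cotangent-decreases : ∀ c s → OnCircle c s → ∀ k →
  (∀ j → j ℕ.< suc k → 0ℚ ℚ.< sine c s (suc j)) →
  0ℚ ℚ.≤ sine c s (suc k) ℚ.* (c ℚ.- ι k ℚ.* (s ℚ.* s)) ℚ.- cosine c s (suc k) ℚ.* s
cotangent-decreases c s unit zero pos = ℚ.≤-reflexive (sym (start c s))
  where
  start : ∀ c s → (s ℚ.* 1ℚ ℚ.+ c ℚ.* 0ℚ) ℚ.* (c ℚ.- 0ℚ ℚ.* (s ℚ.* s)) ℚ.-
                  (c ℚ.* 1ℚ ℚ.- s ℚ.* 0ℚ) ℚ.* s ≡ 0ℚ
  start = solve 2 (λ c s → (s :* con 1ℚ :+ c :* con 0ℚ) :* (c :- con 0ℚ :* (s :* s)) :-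
                           (c :* con 1ℚ :- s :* con 0ℚ) :* s := con 0ℚ) refl
cotangent-decreases c s unit (suc k) pos =
  0≤*-cancelˡ (pos k (ℕ.n≤1+n (suc k))) (subst (0ℚ ℚ.≤_) regroup′
    (0≤+ (0≤* (ℚ.<⇒≤ (pos (suc k) ℕ.≤-refl))
              (cotangent-decreases c s unit k (λ j p → pos j (ℕ.m≤n⇒m≤1+n p))))
         (0≤* (0≤p*p s) 0≤1-yy′)))
  where
  x y y′ : ℚ
  x = cosine c s (suc k)
  y = sine c s (suc k)
  y′ = sine c s (suc (suc k))
  ∣y∣≤1 : ∀ k → ℚ.∣ sine c s k ∣ ℚ.≤ 1ℚ
  ∣y∣≤1 k = ∣sin∣≤1 (cosine c s k) (sine c s k) (onCircle-multiple c s unit k)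
  y≤1 : ∀ k → sine c s k ℚ.≤ 1ℚ
  y≤1 k = ℚ.≤-trans (p≤∣p∣ (sine c s k)) (∣y∣≤1 k)
  split : ∀ y y′ → (1ℚ ℚ.- y) ℚ.+ y ℚ.* (1ℚ ℚ.- y′) ≡ 1ℚ ℚ.- y ℚ.* y′
  split = solve 2 (λ y y′ → (con 1ℚ :- y) :+ y :* (con 1ℚ :- y′) := con 1ℚ :- y :* y′) refl
  0≤1-yy′ : 0ℚ ℚ.≤ 1ℚ ℚ.- y ℚ.* y′
  0≤1-yy′ = subst (0ℚ ℚ.≤_) (split y y′) (0≤+ (0≤q-p (y≤1 (suc k)))
    (0≤* (ℚ.<⇒≤ (pos k (ℕ.n≤1+n (suc k)))) (0≤q-p (y≤1 (suc (suc k))))))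
  regroup : ∀ c s i x y →
    (s ℚ.* x ℚ.+ c ℚ.* y) ℚ.* (y ℚ.* (c ℚ.- i ℚ.* (s ℚ.* s)) ℚ.- x ℚ.* s) ℚ.+
    (s ℚ.* s) ℚ.* ((x ℚ.* x ℚ.+ y ℚ.* y) ℚ.- y ℚ.* (s ℚ.* x ℚ.+ c ℚ.* y)) ≡
    y ℚ.* ((s ℚ.* x ℚ.+ c ℚ.* y) ℚ.* (c ℚ.- (1ℚ ℚ.+ i) ℚ.* (s ℚ.* s)) ℚ.-
           (c ℚ.* x ℚ.- s ℚ.* y) ℚ.* s)
  regroup = solve 5 (λ c s i x y →
    (s :* x :+ c :* y) :* (y :* (c :- i :* (s :* s)) :- x :* s) :+
    (s :* s) :* ((x :* x :+ y :* y) :- y :* (s :* x :+ c :* y)) :=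
    y :* ((s :* x :+ c :* y) :* (c :- (con 1ℚ :+ i) :* (s :* s)) :-
           (c :* x :- s :* y) :* s)) refl
  regroup′ : y′ ℚ.* (y ℚ.* (c ℚ.- ι k ℚ.* (s ℚ.* s)) ℚ.- x ℚ.* s) ℚ.+
             (s ℚ.* s) ℚ.* (1ℚ ℚ.- y ℚ.* y′) ≡
             y ℚ.* (y′ ℚ.* (c ℚ.- ι (suc k) ℚ.* (s ℚ.* s)) ℚ.- cosine c s (suc (suc k)) ℚ.* s)
  regroup′ = subst (λ t → y′ ℚ.* (y ℚ.* (c ℚ.- ι k ℚ.* (s ℚ.* s)) ℚ.- x ℚ.* s) ℚ.+
             (s ℚ.* s) ℚ.* (t ℚ.- y ℚ.* y′) ≡
             y ℚ.* (y′ ℚ.* (c ℚ.- ι (suc k) ℚ.* (s ℚ.* s)) ℚ.- cosine c s (suc (suc k)) ℚ.* s))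
    (onCircle-multiple c s unit (suc k)) (regroup c s (ι k) x y)

-- Eventually the cotangent is at most - cot α, and then the next sine is not
-- positive.
sine-turns : ∀ c s → OnCircle c s → 0ℚ ℚ.< s →
  ∃[ B ] ¬ (∀ j → j ℕ.< B → 0ℚ ℚ.< sine c s (suc j))
sine-turns c s unit 0<s = suc (suc n) , λ pos → ℚ.<-irrefl refl (subst (0ℚ ℚ.<_)
    (vanish c s (ι n) (cosine c s (suc n)) (sine c s (suc n)))
    (0<+0≤ (0<+0≤ (pos (suc n) ℕ.≤-refl)
                  (cotangent-decreases c s unit n (λ j p → pos j (ℕ.m≤n⇒m≤1+n p))))
           (0≤* (ℚ.<⇒≤ (pos n (ℕ.n≤1+n (suc n)))) 0≤ns²-2c)))
  where
  r : ℚ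
  r = proj₁ (inverse (s ℚ.* s) (0<* 0<s 0<s))
  0<r : 0ℚ ℚ.< r
  0<r = proj₁ (proj₂ (inverse (s ℚ.* s) (0<* 0<s 0<s)))
  rs²≡1 : r ℚ.* (s ℚ.* s) ≡ 1ℚ
  rs²≡1 = proj₂ (proj₂ (inverse (s ℚ.* s) (0<* 0<s 0<s)))
  n : ℕ
  n = proj₁ (archimedean (r ℚ.* (c ℚ.+ c)))
  swap : ∀ r s c → (r ℚ.* s) ℚ.* c ≡ (r ℚ.* c) ℚ.* s
  swap = solve 3 (λ r s c → (r :* s) :* c := (r :* c) :* s) refl
  0≤ns²-2c : 0ℚ ℚ.≤ ι n ℚ.* (s ℚ.* s) ℚ.- (c ℚ.+ c)
  0≤ns²-2c = 0≤q-p (subst (ℚ._≤ ι n ℚ.* (s ℚ.* s))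
    (trans (sym (swap r (s ℚ.* s) (c ℚ.+ c))) (inverse-cancel r (s ℚ.* s) (c ℚ.+ c) rs²≡1))
    (ℚ.*-monoʳ-≤-nonNeg (s ℚ.* s) {{ℚ.nonNegative (0≤p*p s)}}
      (proj₂ (archimedean (r ℚ.* (c ℚ.+ c))))))
  vanish : ∀ c s i x y →
    ((s ℚ.* x ℚ.+ c ℚ.* y) ℚ.+ (y ℚ.* (c ℚ.- i ℚ.* (s ℚ.* s)) ℚ.- x ℚ.* s)) ℚ.+
    y ℚ.* (i ℚ.* (s ℚ.* s) ℚ.- (c ℚ.+ c)) ≡ 0ℚ
  vanish = solve 5 (λ c s i x y →
    ((s :* x :+ c :* y) :+ (y :* (c :- i :* (s :* s)) :- x :* s)) :+
    y :* (i :* (s :* s) :- (c :+ c)) := con 0ℚ) refl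

-- The number k of steps with positive sines before the first sine that is not
-- positive.
turning-point : ∀ c s → OnCircle c s → 0ℚ ℚ.< s →
  ∃[ k ] (∀ j → j ℕ.< k → 0ℚ ℚ.< sine c s (suc j)) × sine c s (suc k) ℚ.≤ 0ℚ
turning-point c s unit 0<s =
  [ (λ all → ⊥-elim (proj₂ (sine-turns c s unit 0<s) all))
  , (λ (k , below , ¬P) → k , below , ℚ.≮⇒≥ ¬P) ]′
  (first-failure (λ j → 0ℚ ℚ.<? sine c s (suc j)) (proj₁ (sine-turns c s unit 0<s)))

<⇒≱ : ∀ p q → p ℚ.< q → q ℚ.≤ p → ⊥
<⇒≱ p q p<q q≤p = ℚ.<-irrefl {p} {p} refl (ℚ.<-≤-trans p<q q≤p)

last-positive : ∀ c s k → 0ℚ ℚ.< s → (∀ j → j ℕ.< k → 0ℚ ℚ.< sine c s (suc j)) →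
                sine c s (suc k) ℚ.≤ 0ℚ → 0ℚ ℚ.< sine c s k
last-positive c s zero 0<s pos S≤0 =
  ⊥-elim (<⇒≱ 0ℚ (sine c s 1) (subst (0ℚ ℚ.<_) (sym (sine-1 c s)) 0<s) S≤0)
last-positive c s (suc k) 0<s pos S≤0 = pos k ℕ.≤-refl

near : ∀ p q ε → ℚ.∣ p ℚ.- q ∣ ℚ.≤ ε → p ℚ.- ε ℚ.≤ q
near p q ε h = 0≤q-p⁻¹ (subst (0ℚ ℚ.≤_) (regroup p q ε)
  (0≤q-p (ℚ.≤-trans (p≤∣p∣ (p ℚ.- q)) h)))
  where
  regroup : ∀ p q ε → ε ℚ.- (p ℚ.- q) ≡ q ℚ.- (p ℚ.- ε)
  regroup = solve 3 (λ p q ε → ε :- (p :- q) := q :- (p :- ε)) refl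

∣sg*p∣ : ∀ k p → ℚ.∣ sg k ℚ.* p ∣ ≡ ℚ.∣ p ∣
∣sg*p∣ zero    p = cong ℚ.∣_∣ (ℚ.*-identityˡ p)
∣sg*p∣ (suc k) p = trans (cong ℚ.∣_∣ (sym (ℚ.neg-distribˡ-* (sg k) p)))
  (trans (ℚ.∣-p∣≡∣p∣ (sg k ℚ.* p)) (∣sg*p∣ k p))

-- Rotation up to the first multiple K whose sine is not positive: this multiple
-- is a half turn up to an error of one step.
module Turn (c s : ℚ) (unit : OnCircle c s) (0≤1-c : 0ℚ ℚ.≤ 1ℚ ℚ.- c)
            (0<c : 0ℚ ℚ.< c) (0<s : 0ℚ ℚ.< s)
            (k₀ : ℕ) (S>0 : ∀ j → j ℕ.< k₀ → 0ℚ ℚ.< sine c s (suc j))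
            (S[K]≤0 : sine c s (suc k₀) ℚ.≤ 0ℚ) where

  open Steps c s unit 0≤1-c (ℚ.<⇒≤ 0<s) public

  K : ℕ
  K = suc k₀

  S[k₀]>0 : 0ℚ ℚ.< S k₀
  S[k₀]>0 = last-positive c s k₀ 0<s S>0 S[K]≤0

  0≤-S[K] : 0ℚ ℚ.≤ ℚ.- S K
  0≤-S[K] = ℚ.neg-antimono-≤ S[K]≤0

  -- Rotating the K-th multiple back by one step gives a positive sine.
  0<-C[K] : 0ℚ ℚ.< ℚ.- C K
  0<-C[K] = 0<*-cancelˡ (ℚ.<⇒≤ 0<s) (subst (0ℚ ℚ.<_)
    (subst (λ t → t ℚ.* S k₀ ℚ.+ c ℚ.* (ℚ.- S K) ≡ s ℚ.* (ℚ.- C K)) unit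
      (rotate-back c s (C k₀) (S k₀)))
    (0<+0≤ (subst (0ℚ ℚ.<_) (sym (ℚ.*-identityˡ (S k₀))) S[k₀]>0)
           (0≤* (ℚ.<⇒≤ 0<c) 0≤-S[K])))
    where
    rotate-back : ∀ c s x y →
      (c ℚ.* c ℚ.+ s ℚ.* s) ℚ.* y ℚ.+ c ℚ.* (ℚ.- (s ℚ.* x ℚ.+ c ℚ.* y)) ≡
      s ℚ.* (ℚ.- (c ℚ.* x ℚ.- s ℚ.* y))
    rotate-back = solve 4 (λ c s x y →
      (c :* c :+ s :* s) :* y :+ c :* (:- (s :* x :+ c :* y)) :=
      s :* (:- (c :* x :- s :* y))) refl

  -S[K]≤η : ℚ.- S K ℚ.≤ η
  -S[K]≤η = ℚ.≤-trans
    (subst (ℚ._≤ S k₀ ℚ.- S K) (ℚ.+-identityˡ (ℚ.- S K))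
      (ℚ.+-monoˡ-≤ (ℚ.- S K) (ℚ.<⇒≤ S[k₀]>0)))
    (ℚ.≤-trans (p≤∣p∣ (S k₀ ℚ.- S K)) (sine-step k₀))

  0≤1+C[K] : 0ℚ ℚ.≤ 1ℚ ℚ.- (ℚ.- C K)
  0≤1+C[K] = 0≤q-p (ℚ.≤-trans (-p≤∣p∣ (C K)) (∣C∣≤1 K))

  -- On the circle, 1 + x ≤ 1 - x² = y² ≤ -y when x, y ≤ 0.
  1+C[K]≤-S[K] : 1ℚ ℚ.- (ℚ.- C K) ℚ.≤ ℚ.- S K
  1+C[K]≤-S[K] = 0≤q-p⁻¹ (subst (0ℚ ℚ.≤_)
    (trans (expand (C K) (S K)) (subst
      (λ t → ((ℚ.- S K) ℚ.- (1ℚ ℚ.- (ℚ.- C K))) ℚ.+ (1ℚ ℚ.- t) ≡ (ℚ.- S K) ℚ.- (1ℚ ℚ.- (ℚ.- C K)))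
      (sym (onCircle-multiple c s unit K)) (drop ((ℚ.- S K) ℚ.- (1ℚ ℚ.- (ℚ.- C K))))))
    (0≤+ (0≤* 0≤-S[K] (0≤q-p (ℚ.≤-trans (-p≤∣p∣ (S K)) (∣S∣≤1 K))))
         (0≤* 0≤1+C[K] (ℚ.<⇒≤ 0<-C[K]))))
    where
    drop : ∀ x → x ℚ.+ (1ℚ ℚ.- 1ℚ) ≡ x
    drop = solve 1 (λ x → x :+ (con 1ℚ :- con 1ℚ) := x) refl
    expand : ∀ x y →
      (ℚ.- y) ℚ.* (1ℚ ℚ.- (ℚ.- y)) ℚ.+ (1ℚ ℚ.- (ℚ.- x)) ℚ.* (ℚ.- x) ≡
      ((ℚ.- y) ℚ.- (1ℚ ℚ.- (ℚ.- x))) ℚ.+ (1ℚ ℚ.- (x ℚ.* x ℚ.+ y ℚ.* y))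
    expand = solve 2 (λ x y →
      (:- y) :* (con 1ℚ :- (:- y)) :+ (con 1ℚ :- (:- x)) :* (:- x) :=
      ((:- y) :- (con 1ℚ :- (:- x))) :+ (con 1ℚ :- (x :* x :+ y :* y))) refl

  -- The k-th multiple of the near half turn is close to k half turns, whose cosine
  -- is (-1)^k.
  cosine-half-turns : ∀ k → 1ℚ ℚ.- ι k ℚ.* (η ℚ.+ η) ℚ.≤ sg k ℚ.* C (k ℕ.* K)
  cosine-half-turns k = subst (1ℚ ℚ.- ι k ℚ.* (η ℚ.+ η) ℚ.≤_) multiple
    (near 1ℚ (H.C (k ℕ.+ 0)) (ι k ℚ.* (η ℚ.+ η))
      (ℚ.≤-trans (H.cosine-steps k 0)
        (ℚ.*-monoˡ-≤-nonNeg (ι k) {{ℚ.nonNegative (ι≥0 k)}} ηH≤)))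
    where
    module H = Steps (ℚ.- C K) (ℚ.- S K)
      (onCircle-neg (C K) (S K) (onCircle-multiple c s unit K)) 0≤1+C[K] 0≤-S[K]
    ηH≤ : H.η ℚ.≤ η ℚ.+ η
    ηH≤ = ℚ.+-mono-≤ (ℚ.≤-trans 1+C[K]≤-S[K] -S[K]≤η) -S[K]≤η
    multiple : H.C (k ℕ.+ 0) ≡ sg k ℚ.* C (k ℕ.* K)
    multiple = trans (cong H.C (ℕ.+-identityʳ k))
      (trans (cosine-neg (C K) (S K) k) (cong (sg k ℚ.*_) (cosine-* c s K k)))

  -- If M * e falls short of K by at most e, then the cosine of the multiple
  -- e * k * M is close to that of k * K: at most k * e ≤ e * e steps lie between.
  cosine-aligned : ∀ e r M k → r ℕ.≤ e → K ≡ r ℕ.+ M ℕ.* e → k ℕ.≤ e →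
    1ℚ ℚ.- (ι (e ℕ.* e) ℚ.+ (ι e ℚ.+ ι e)) ℚ.* η ℚ.≤ sg k ℚ.* C ((e ℕ.* k) ℕ.* M)
  cosine-aligned e r M k r≤e K≡ k≤e = subst (bound ℚ.≤_) (cong (λ n → sg k ℚ.* C n) index-a)
    (0≤q-p⁻¹ (subst (0ℚ ℚ.≤_)
      (combine (sg k) (C a) (C b) (ι k) (ι e) (ι (e ℕ.* e)) η)
      (0≤+ (0≤+ (0≤q-p half-turns) (0≤q-p shift-bound))
           (0≤* (0≤q-p (ι-mono k≤e)) (0≤+ 0≤η 0≤η)))))
    where
    a b : ℕ
    a = k ℕ.* (M ℕ.* e)
    b = k ℕ.* r ℕ.+ a
    bound : ℚ
    bound = 1ℚ ℚ.- (ι (e ℕ.* e) ℚ.+ (ι e ℚ.+ ι e)) ℚ.* η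
    index-a : a ≡ (e ℕ.* k) ℕ.* M
    index-a = ℕ-solve 3 (λ k M e → k ⊛ (M ⊛ e) ≔ (e ⊛ k) ⊛ M) refl k M e
    index-b : k ℕ.* K ≡ b
    index-b = trans (cong (k ℕ.*_) K≡) (ℕ.*-distribˡ-+ k r (M ℕ.* e))
    half-turns : 1ℚ ℚ.- ι k ℚ.* (η ℚ.+ η) ℚ.≤ sg k ℚ.* C b
    half-turns = subst (λ n → 1ℚ ℚ.- ι k ℚ.* (η ℚ.+ η) ℚ.≤ sg k ℚ.* C n) index-b
      (cosine-half-turns k)
    shift-bound : ℚ.- (sg k ℚ.* (C a ℚ.- C b)) ℚ.≤ ι (e ℕ.* e) ℚ.* η
    shift-bound = ℚ.≤-trans (-p≤∣p∣ (sg k ℚ.* (C a ℚ.- C b)))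
      (subst (ℚ._≤ ι (e ℕ.* e) ℚ.* η) (sym (∣sg*p∣ k (C a ℚ.- C b)))
        (ℚ.≤-trans (cosine-steps (k ℕ.* r) a)
          (ℚ.*-monoʳ-≤-nonNeg η {{ℚ.nonNegative 0≤η}} (ι-mono (ℕ.*-mono-≤ k≤e r≤e)))))
    combine : ∀ t x y i j l η →
      ((t ℚ.* y ℚ.- (1ℚ ℚ.- i ℚ.* (η ℚ.+ η))) ℚ.+ (l ℚ.* η ℚ.- (ℚ.- (t ℚ.* (x ℚ.- y))))) ℚ.+
      (j ℚ.- i) ℚ.* (η ℚ.+ η) ≡ t ℚ.* x ℚ.- (1ℚ ℚ.- (l ℚ.+ (j ℚ.+ j)) ℚ.* η)
    combine = solve 7 (λ t x y i j l η →
      ((t :* y :- (con 1ℚ :- i :* (η :+ η))) :+ (l :* η :- (:- (t :* (x :- y))))) :+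
      (j :- i) :* (η :+ η) := t :* x :- (con 1ℚ :- (l :+ (j :+ j)) :* η)) refl

  -- The near half turn takes more than e steps when the steps are small.
  many-steps : ∀ e → ι e ℚ.* η ℚ.≤ 1ℚ → ¬ (K ℕ.≤ e)
  many-steps e small K≤e = <⇒≱ (C K) 0ℚ
    (subst (ℚ._< 0ℚ) (neg-involutive (C K)) (ℚ.neg-antimono-< 0<-C[K]))
    (ℚ.≤-trans (0≤q-p (ℚ.≤-trans (ℚ.*-monoʳ-≤-nonNeg η {{ℚ.nonNegative 0≤η}} (ι-mono K≤e)) small))
      (subst (λ n → 1ℚ ℚ.- ι K ℚ.* η ℚ.≤ C n) (ℕ.+-identityʳ K)
        (near 1ℚ (C (K ℕ.+ 0)) (ι K ℚ.* η) (cosine-steps K 0))))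

  S-positive : ∀ n → 0 ℕ.< n → n ℕ.≤ k₀ → 0ℚ ℚ.< S n
  S-positive (suc n) _ n<k₀ = S>0 n n<k₀

-- Rational points close to the Chebyshev extrema

-- An angle with small steps: the point of the circle given by the tangent t of
-- half the angle, c = (1 - t²) / (1 + t²) and s = 2 t / (1 + t²), with t = ε / 4.
small-rotation : ∀ ε → 0ℚ ℚ.< ε → ε ℚ.≤ 1ℚ →
  ∃[ c ] ∃[ s ] OnCircle c s × 0ℚ ℚ.< c × 0ℚ ℚ.< s × 0ℚ ℚ.≤ 1ℚ ℚ.- c ×
                (1ℚ ℚ.- c) ℚ.+ s ℚ.≤ ε
small-rotation ε 0<ε ε≤1 = c , s , unit , 0<c , 0<s , 0≤1-c , bound
  where
  t : ℚ
  t = ½ ℚ.* (½ ℚ.* ε)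
  0<t : 0ℚ ℚ.< t
  0<t = half>0 (half>0 0<ε)
  4t≡ε : (t ℚ.+ t) ℚ.+ (t ℚ.+ t) ≡ ε
  4t≡ε = quarter ε
    where
    quarter : ∀ ε → (½ ℚ.* (½ ℚ.* ε) ℚ.+ ½ ℚ.* (½ ℚ.* ε)) ℚ.+
                    (½ ℚ.* (½ ℚ.* ε) ℚ.+ ½ ℚ.* (½ ℚ.* ε)) ≡ ε
    quarter = solve 1 (λ ε → (con ½ :* (con ½ :* ε) :+ con ½ :* (con ½ :* ε)) :+
                             (con ½ :* (con ½ :* ε) :+ con ½ :* (con ½ :* ε)) := ε) refl
  0<1-t : 0ℚ ℚ.< 1ℚ ℚ.- t
  0<1-t = 0<q-p (ℚ.<-≤-trans t<ε ε≤1)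
    where
    t<ε : t ℚ.< ε
    t<ε = 0<q-p⁻¹ (subst (0ℚ ℚ.<_) (trans (rest t) (cong (ℚ._- t) 4t≡ε))
      (0<+0≤ 0<t (ℚ.<⇒≤ (0<+0≤ 0<t (ℚ.<⇒≤ 0<t)))))
      where
      rest : ∀ t → t ℚ.+ (t ℚ.+ t) ≡ ((t ℚ.+ t) ℚ.+ (t ℚ.+ t)) ℚ.- t
      rest = solve 1 (λ t → t :+ (t :+ t) := ((t :+ t) :+ (t :+ t)) :- t) refl
  0<1+t² : 0ℚ ℚ.< 1ℚ ℚ.+ t ℚ.* t
  0<1+t² = 0<+0≤ 0<1 (0≤p*p t)
  w : ℚ
  w = proj₁ (inverse (1ℚ ℚ.+ t ℚ.* t) 0<1+t²)
  0<w : 0ℚ ℚ.< w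
  0<w = proj₁ (proj₂ (inverse (1ℚ ℚ.+ t ℚ.* t) 0<1+t²))
  w[1+t²]≡1 : w ℚ.* (1ℚ ℚ.+ t ℚ.* t) ≡ 1ℚ
  w[1+t²]≡1 = proj₂ (proj₂ (inverse (1ℚ ℚ.+ t ℚ.* t) 0<1+t²))
  c s : ℚ
  c = (1ℚ ℚ.- t ℚ.* t) ℚ.* w
  s = (t ℚ.+ t) ℚ.* w
  unit : OnCircle c s
  unit = trans (square t w) (cong₂ ℚ._*_ w[1+t²]≡1 w[1+t²]≡1)
    where
    square : ∀ t w → ((1ℚ ℚ.- t ℚ.* t) ℚ.* w) ℚ.* ((1ℚ ℚ.- t ℚ.* t) ℚ.* w) ℚ.+
                     ((t ℚ.+ t) ℚ.* w) ℚ.* ((t ℚ.+ t) ℚ.* w) ≡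
                     (w ℚ.* (1ℚ ℚ.+ t ℚ.* t)) ℚ.* (w ℚ.* (1ℚ ℚ.+ t ℚ.* t))
    square = solve 2 (λ t w → ((con 1ℚ :- t :* t) :* w) :* ((con 1ℚ :- t :* t) :* w) :+
                     ((t :+ t) :* w) :* ((t :+ t) :* w) :=
                     (w :* (con 1ℚ :+ t :* t)) :* (w :* (con 1ℚ :+ t :* t))) refl
  0<c : 0ℚ ℚ.< c
  0<c = 0<* (subst (0ℚ ℚ.<_) (factor t) (0<* 0<1-t (0<+0≤ 0<1 (ℚ.<⇒≤ 0<t)))) 0<w
    where
    factor : ∀ t → (1ℚ ℚ.- t) ℚ.* (1ℚ ℚ.+ t) ≡ 1ℚ ℚ.- t ℚ.* t
    factor = solve 1 (λ t → (con 1ℚ :- t) :* (con 1ℚ :+ t) := con 1ℚ :- t :* t) refl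
  0<s : 0ℚ ℚ.< s
  0<s = 0<* (0<+0≤ 0<t (ℚ.<⇒≤ 0<t)) 0<w
  1-c≡ : (t ℚ.* t ℚ.+ t ℚ.* t) ℚ.* w ≡ 1ℚ ℚ.- c
  1-c≡ = subst (λ x → (t ℚ.* t ℚ.+ t ℚ.* t) ℚ.* w ≡ x ℚ.- c) w[1+t²]≡1 (expand t w)
    where
    expand : ∀ t w → (t ℚ.* t ℚ.+ t ℚ.* t) ℚ.* w ≡
                     w ℚ.* (1ℚ ℚ.+ t ℚ.* t) ℚ.- (1ℚ ℚ.- t ℚ.* t) ℚ.* w
    expand = solve 2 (λ t w → (t :* t :+ t :* t) :* w :=
                     w :* (con 1ℚ :+ t :* t) :- (con 1ℚ :- t :* t) :* w) refl
  0≤2t²w : 0ℚ ℚ.≤ (t ℚ.* t ℚ.+ t ℚ.* t) ℚ.* w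
  0≤2t²w = 0≤* (0≤+ (0≤p*p t) (0≤p*p t)) (ℚ.<⇒≤ 0<w)
  0≤1-c : 0ℚ ℚ.≤ 1ℚ ℚ.- c
  0≤1-c = subst (0ℚ ℚ.≤_) 1-c≡ 0≤2t²w
  -- Since w ≤ 1, the sum is at most 2t² + 2t ≤ 4t.
  bound : (1ℚ ℚ.- c) ℚ.+ s ℚ.≤ ε
  bound = subst₂ (λ x y → x ℚ.+ s ℚ.≤ y) 1-c≡ 4t≡ε (0≤q-p⁻¹ (subst (0ℚ ℚ.≤_) slack
    (0≤+ (0≤* (ℚ.<⇒≤ (0<+0≤ 0<t (ℚ.<⇒≤ 0<t))) (ℚ.<⇒≤ 0<1-t))
         (0≤* (0≤+ (0≤+ (0≤p*p t) (0≤p*p t)) (0≤+ (ℚ.<⇒≤ 0<t) (ℚ.<⇒≤ 0<t)))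
              (0≤* (ℚ.<⇒≤ 0<w) (0≤p*p t))))))
    where
    expand : ∀ t w →
      (t ℚ.+ t) ℚ.* (1ℚ ℚ.- t) ℚ.+
      ((t ℚ.* t ℚ.+ t ℚ.* t) ℚ.+ (t ℚ.+ t)) ℚ.* (w ℚ.* (1ℚ ℚ.+ t ℚ.* t) ℚ.- w) ≡
      (((t ℚ.+ t) ℚ.- (t ℚ.* t ℚ.+ t ℚ.* t)) ℚ.+
       ((t ℚ.* t ℚ.+ t ℚ.* t) ℚ.+ (t ℚ.+ t)) ℚ.* (w ℚ.* (1ℚ ℚ.+ t ℚ.* t))) ℚ.-
      ((t ℚ.* t ℚ.+ t ℚ.* t) ℚ.* w ℚ.+ (t ℚ.+ t) ℚ.* w)
    expand = solve 2 (λ t w →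
      (t :+ t) :* (con 1ℚ :- t) :+
      ((t :* t :+ t :* t) :+ (t :+ t)) :* (w :* (con 1ℚ :+ t :* t) :- w) :=
      (((t :+ t) :- (t :* t :+ t :* t)) :+
       ((t :* t :+ t :* t) :+ (t :+ t)) :* (w :* (con 1ℚ :+ t :* t))) :-
      ((t :* t :+ t :* t) :* w :+ (t :+ t) :* w)) refl
    excess : ∀ t w → w ℚ.* (t ℚ.* t) ≡ w ℚ.* (1ℚ ℚ.+ t ℚ.* t) ℚ.- w
    excess = solve 2 (λ t w → w :* (t :* t) := w :* (con 1ℚ :+ t :* t) :- w) refl
    total : ∀ t → ((t ℚ.+ t) ℚ.- (t ℚ.* t ℚ.+ t ℚ.* t)) ℚ.+
                  ((t ℚ.* t ℚ.+ t ℚ.* t) ℚ.+ (t ℚ.+ t)) ℚ.* 1ℚ ≡ (t ℚ.+ t) ℚ.+ (t ℚ.+ t)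
    total = solve 1 (λ t → ((t :+ t) :- (t :* t :+ t :* t)) :+
                  ((t :* t :+ t :* t) :+ (t :+ t)) :* con 1ℚ := (t :+ t) :+ (t :+ t)) refl
    2t²+2t : ℚ
    2t²+2t = (t ℚ.* t ℚ.+ t ℚ.* t) ℚ.+ (t ℚ.+ t)
    slack : (t ℚ.+ t) ℚ.* (1ℚ ℚ.- t) ℚ.+ 2t²+2t ℚ.* (w ℚ.* (t ℚ.* t)) ≡
            ((t ℚ.+ t) ℚ.+ (t ℚ.+ t)) ℚ.- ((t ℚ.* t ℚ.+ t ℚ.* t) ℚ.* w ℚ.+ s)
    slack = trans
      (cong (λ x → (t ℚ.+ t) ℚ.* (1ℚ ℚ.- t) ℚ.+ 2t²+2t ℚ.* x) (excess t w))
      (trans (expand t w) (cong (ℚ._- ((t ℚ.* t ℚ.+ t ℚ.* t) ℚ.* w ℚ.+ s))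
        (trans (cong (λ x → ((t ℚ.+ t) ℚ.- (t ℚ.* t ℚ.+ t ℚ.* t)) ℚ.+ 2t²+2t ℚ.* x) w[1+t²]≡1)
               (total t))))

-- If the first e multiples of an angle have positive sine, then the multiples up
-- to e / 2 have positive and decreasing cosine.
module FirstQuadrant (c s : ℚ) (unit : OnCircle c s) (e m : ℕ) (2m≤e : m ℕ.* 2 ℕ.≤ e)
                     (S>0 : ∀ j → j ℕ.< e → 0ℚ ℚ.< sine c s (suc j)) where

  -- By sin 2φ = 2 sin φ cos φ.
  cosine-positive : ∀ k → k ℕ.≤ m → 0ℚ ℚ.< cosine c s k
  cosine-positive zero    _   = 0<1
  cosine-positive (suc k) k<m = 0<*-cancelˡ (ℚ.<⇒≤ (0<+0≤ Sk>0 (ℚ.<⇒≤ Sk>0)))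
    (subst (0ℚ ℚ.<_) (double (cosine c s (suc k)) (sine c s (suc k)))
      (subst (0ℚ ℚ.<_) (sine-+ c s (suc k) (suc k)) (S>0 (k ℕ.+ suc k) 2k<e)))
    where
    2k<e : suc (k ℕ.+ suc k) ℕ.≤ e
    2k<e = ℕ.≤-trans (ℕ.≤-reflexive (ℕ-solve 1 (λ k → k ⊞ k ≔ k ⊛ ℕ-con 2) refl (suc k)))
      (ℕ.≤-trans (ℕ.*-monoˡ-≤ 2 k<m) 2m≤e)
    Sk>0 : 0ℚ ℚ.< sine c s (suc k)
    Sk>0 = S>0 k (ℕ.≤-trans (ℕ.s≤s (ℕ.m≤m+n k (suc k))) 2k<e)
    double : ∀ x y → y ℚ.* x ℚ.+ x ℚ.* y ≡ (y ℚ.+ y) ℚ.* x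
    double = solve 2 (λ x y → y :* x :+ x :* y := (y :+ y) :* x) refl

  cosine-decreasing : ∀ k → k ℕ.< m → cosine c s (suc k) ℚ.< cosine c s k
  cosine-decreasing k k<m = 0<q-p⁻¹ (subst (0ℚ ℚ.<_)
    (step-difference c s (cosine c s k) (sine c s k))
    (0<+0≤ (0<* 0<1-c (cosine-positive k (ℕ.<⇒≤ k<m))) (0≤* (ℚ.<⇒≤ 0<s) (S≥0 k (ℕ.<⇒≤ k<e)))))
    where
    k<e : k ℕ.< e
    k<e = ℕ.≤-trans k<m (ℕ.≤-trans (ℕ.m≤m*n m 2) 2m≤e)
    0<s : 0ℚ ℚ.< s
    0<s = subst (0ℚ ℚ.<_) (sine-1 c s) (S>0 0 (ℕ.≤-trans (ℕ.s≤s ℕ.z≤n) k<e))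
    S≥0 : ∀ k → k ℕ.≤ e → 0ℚ ℚ.≤ sine c s k
    S≥0 zero    _   = ℚ.≤-refl
    S≥0 (suc k) k<e = ℚ.<⇒≤ (S>0 k k<e)
    expand : ∀ c s → s ℚ.* s ℚ.+ (1ℚ ℚ.- (c ℚ.* c ℚ.+ s ℚ.* s)) ≡ (1ℚ ℚ.- (ℚ.- c)) ℚ.* (1ℚ ℚ.- c)
    expand = solve 2 (λ c s → s :* s :+ (con 1ℚ :- (c :* c :+ s :* s)) :=
                              (con 1ℚ :- (:- c)) :* (con 1ℚ :- c)) refl
    0<1-c : 0ℚ ℚ.< 1ℚ ℚ.- c
    0<1-c = 0<*-cancelˡ (0≤q-p (ℚ.≤-trans (-p≤∣p∣ c) (∣cos∣≤1 c s unit)))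
      (subst (0ℚ ℚ.<_) (expand c s) (0<+0≤ (0<* 0<s 0<s)
        (ℚ.≤-reflexive (sym (trans (cong (λ x → 1ℚ ℚ.- x) unit) (ℚ.+-inverseʳ 1ℚ))))))

-- Rational approximations to the extrema cos (k π / e), k ≤ m, of the Chebyshev
-- polynomial of degree e ≥ 1: the cosines of the multiples of a rational angle close
-- to π / e.  At the k-th of them the polynomial takes the value cosine c s (e * k),
-- which is within δ of (-1)^k.
record Extrema (e m : ℕ) (δ : ℚ) : Set where
  field
    c s         : ℚ
    unit        : OnCircle c s
    positive    : ∀ k → k ℕ.≤ m → 0ℚ ℚ.< cosine c s k
    decreasing  : ∀ k → k ℕ.< m → cosine c s (suc k) ℚ.< cosine c s k
    alternating : ∀ k → k ℕ.≤ m → 1ℚ ℚ.- δ ℚ.≤ sg k ℚ.* cosine c s (e ℕ.* k)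

-- With K = r + M * e and r ≤ e, the angle of M small steps serves as the
-- approximation to π / e.  The hypothesis on the step size collects the errors
-- of cosine-aligned.
module Construction (e : ℕ) {{_ : ℕ.NonZero e}} (m : ℕ) (2m≤e : m ℕ.* 2 ℕ.≤ e)
  (δ : ℚ) (δ≤1 : δ ℚ.≤ 1ℚ) (c s : ℚ) (unit : OnCircle c s)
  (0<c : 0ℚ ℚ.< c) (0<s : 0ℚ ℚ.< s) (0≤1-c : 0ℚ ℚ.≤ 1ℚ ℚ.- c)
  (small : (ι (e ℕ.* e) ℚ.+ (ι e ℚ.+ ι e)) ℚ.* ((1ℚ ℚ.- c) ℚ.+ s) ℚ.≤ δ)
  (k₀ : ℕ) (S>0 : ∀ j → j ℕ.< k₀ → 0ℚ ℚ.< sine c s (suc j))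
  (S[K]≤0 : sine c s (suc k₀) ℚ.≤ 0ℚ) where

  open Turn c s unit 0≤1-c 0<c 0<s k₀ S>0 S[K]≤0

  M r : ℕ
  M = k₀ ℕ./ e
  r = suc (k₀ ℕ.% e)

  r≤e : r ℕ.≤ e
  r≤e = ℕ.m%n<n k₀ e

  K≡r+Me : K ≡ r ℕ.+ M ℕ.* e
  K≡r+Me = cong suc (ℕ.m≡m%n+[m/n]*n k₀ e)

  Me≤k₀ : M ℕ.* e ℕ.≤ k₀
  Me≤k₀ = ℕ.m/n*n≤m k₀ e

  eη≤1 : ι e ℚ.* η ℚ.≤ 1ℚ
  eη≤1 = ℚ.≤-trans
    (ℚ.*-monoʳ-≤-nonNeg η {{ℚ.nonNegative 0≤η}}
      (subst (ι e ℚ.≤_) (swap (ι e) (ι (e ℕ.* e)))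
        (p≤p+q (ι e) (ι e ℚ.+ ι (e ℕ.* e)) (0≤+ (ι≥0 e) (ι≥0 (e ℕ.* e))))))
    (ℚ.≤-trans small δ≤1)
    where
    swap : ∀ x y → x ℚ.+ (x ℚ.+ y) ≡ y ℚ.+ (x ℚ.+ x)
    swap = solve 2 (λ x y → x :+ (x :+ y) := y :+ (x :+ x)) refl

  M>0 : 0 ℕ.< M
  M>0 = ℕ.n≢0⇒n>0 λ M≡0 → many-steps e eη≤1 (ℕ.≤-trans
    (ℕ.≤-reflexive (trans K≡r+Me (trans (cong (λ M → r ℕ.+ M ℕ.* e) M≡0) (ℕ.+-identityʳ r)))) r≤e)

  sine-positive : ∀ j → j ℕ.< e → 0ℚ ℚ.< sine (C M) (S M) (suc j)
  sine-positive j j<e = subst (0ℚ ℚ.<_) (sym (sine-* c s M (suc j)))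
    (S-positive (suc j ℕ.* M) (ℕ.≤-trans M>0 (ℕ.m≤m+n M (j ℕ.* M)))
      (ℕ.≤-trans (ℕ.*-monoˡ-≤ M j<e)
        (ℕ.≤-trans (ℕ.≤-reflexive (ℕ.*-comm e M)) Me≤k₀)))

  onCircle-M : OnCircle (C M) (S M)
  onCircle-M = onCircle-multiple c s unit M

  open FirstQuadrant (C M) (S M) onCircle-M e m 2m≤e sine-positive public

  k≤m⇒k≤e : ∀ k → k ℕ.≤ m → k ℕ.≤ e
  k≤m⇒k≤e k k≤m = ℕ.≤-trans k≤m (ℕ.≤-trans (ℕ.m≤m*n m 2) 2m≤e)

  cosine-alternating : ∀ k → k ℕ.≤ m →
    1ℚ ℚ.- δ ℚ.≤ sg k ℚ.* cosine (C M) (S M) (e ℕ.* k)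
  cosine-alternating k k≤m = ℚ.≤-trans
    (ℚ.+-monoʳ-≤ 1ℚ (ℚ.neg-antimono-≤ small))
    (subst (λ x → 1ℚ ℚ.- (ι (e ℕ.* e) ℚ.+ (ι e ℚ.+ ι e)) ℚ.* η ℚ.≤ sg k ℚ.* x)
      (sym (cosine-* c s M (e ℕ.* k)))
      (cosine-aligned e r M k r≤e K≡r+Me (k≤m⇒k≤e k k≤m)))

  extrema : Extrema e m δ
  extrema = record
    { c           = C M
    ; s           = S M
    ; unit        = onCircle-M
    ; positive    = cosine-positive
    ; decreasing  = cosine-decreasing
    ; alternating = cosine-alternating
    }

-- For e = 0 there is only the point 1, and any angle serves.
extrema-exist : ∀ e m δ → m ℕ.* 2 ℕ.≤ e → 0ℚ ℚ.< δ → δ ℚ.≤ 1ℚ → Extrema e m δ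
extrema-exist zero zero δ _ 0<δ δ≤1 = record
  { c           = 1ℚ
  ; s           = 0ℚ
  ; unit        = refl
  ; positive    = λ { zero _ → 0<1 }
  ; decreasing  = λ _ ()
  ; alternating = λ { zero _ → 0≤q-p⁻¹ (subst (0ℚ ℚ.≤_) (slack δ) (ℚ.<⇒≤ 0<δ)) }
  }
  where
  slack : ∀ δ → δ ≡ 1ℚ ℚ.* 1ℚ ℚ.- (1ℚ ℚ.- δ)
  slack = solve 1 (λ δ → δ := con 1ℚ :* con 1ℚ :- (con 1ℚ :- δ)) refl
extrema-exist e@(suc e-1) m δ 2m≤e 0<δ δ≤1 =
  let L = ι (e ℕ.* e) ℚ.+ (ι e ℚ.+ ι e)
      ε , 0<ε , ε≤1 , εL≤δ = small-multiplier L δ L>0 0<δ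
      c , s , unit , 0<c , 0<s , 0≤1-c , η≤ε = small-rotation ε 0<ε ε≤1
      small = ℚ.≤-trans (ℚ.*-monoˡ-≤-nonNeg L {{ℚ.nonNegative (ℚ.<⇒≤ L>0)}} η≤ε)
                        (subst (ℚ._≤ δ) (ℚ.*-comm ε L) εL≤δ)
      k₀ , S>0 , S[K]≤0 = turning-point c s unit 0<s
  in Construction.extrema e m 2m≤e δ δ≤1 c s unit 0<c 0<s 0≤1-c small k₀ S>0 S[K]≤0
  where
  ιe>0 : 0ℚ ℚ.< ι e
  ιe>0 = 0<+0≤ 0<1 (ι≥0 e-1)
  L>0 : 0ℚ ℚ.< ι (e ℕ.* e) ℚ.+ (ι e ℚ.+ ι e)
  L>0 = subst (0ℚ ℚ.<_) (ℚ.+-comm (ι e ℚ.+ ι e) (ι (e ℕ.* e)))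
    (0<+0≤ (0<+0≤ ιe>0 (ι≥0 e)) (ι≥0 (e ℕ.* e)))

-- Multilinear polynomials

∑⊆-cong : ∀ n {g h : Subset n → ℝ} → (∀ S → g S ≈ h S) → ∑⊆ n g ≈ ∑⊆ n h
∑⊆-cong zero    eq = eq []
∑⊆-cong (suc n) eq = +-cong (∑⊆-cong n (λ S → eq (outside ∷ S)))
                            (∑⊆-cong n (λ S → eq (inside ∷ S)))

∑⊆-linear : ∀ n (g : Subset n → ℝ) k h →
  ∑⊆ n (λ S → g S + k * h S) ≈ ∑⊆ n g + k * ∑⊆ n h
∑⊆-linear zero    g k h = ≈-refl
∑⊆-linear (suc n) g k h = ≈-trans
  (+-cong (∑⊆-linear n (λ S → g (outside ∷ S)) k (λ S → h (outside ∷ S)))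
          (∑⊆-linear n (λ S → g (inside ∷ S)) k (λ S → h (inside ∷ S))))
  (termwise⇒≈ λ m → regroup (seq k m)
    (seq (∑⊆ n (λ S → g (outside ∷ S))) m) (seq (∑⊆ n (λ S → g (inside ∷ S))) m)
    (seq (∑⊆ n (λ S → h (outside ∷ S))) m) (seq (∑⊆ n (λ S → h (inside ∷ S))) m))
  where
  regroup : ∀ k a b c d → (a ℚ.+ k ℚ.* c) ℚ.+ (b ℚ.+ k ℚ.* d) ≡
                          (a ℚ.+ b) ℚ.+ k ℚ.* (c ℚ.+ d)
  regroup = solve 5 (λ k a b c d → (a :+ k :* c) :+ (b :+ k :* d) :=
                                   (a :+ b) :+ k :* (c :+ d)) refl

∑⊆-zero : ∀ n {g : Subset n → ℝ} → (∀ S → g S ≈ 0ℝ) → ∑⊆ n g ≈ 0ℝ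
∑⊆-zero zero    eq = eq []
∑⊆-zero (suc n) eq = ≈-trans
  (+-cong (∑⊆-zero n (λ S → eq (outside ∷ S))) (∑⊆-zero n (λ S → eq (inside ∷ S))))
  (0+ 0ℝ)

-- The product of the coordinates in S at an arbitrary real point.
monomial : ∀ {n} → Subset n → Vec ℝ n → ℝ
monomial []            []      = 1ℝ
monomial (inside  ∷ S) (z ∷ w) = z * monomial S w
monomial (outside ∷ S) (z ∷ w) = monomial S w

-- The multilinear polynomial with coefficients f̂.
multilinear : ∀ {n} → (Subset n → ℝ) → Vec ℝ n → ℝ
multilinear {n} f̂ z = ∑⊆ n (λ S → f̂ S * monomial S z)

χ≡monomial : ∀ {n} (S : Subset n) x → χ S x ≡ monomial S (map sign x)
χ≡monomial []            []      = refl
χ≡monomial (inside  ∷ S) (x ∷ w) = cong (sign x *_) (χ≡monomial S w)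
χ≡monomial (outside ∷ S) (x ∷ w) = χ≡monomial S w

-- Substituting z for the first variable.
specialize : ∀ {n} → (Subset (suc n) → ℝ) → ℝ → Subset n → ℝ
specialize f̂ z S = f̂ (outside ∷ S) + z * f̂ (inside ∷ S)

multilinear-first : ∀ {n} (f̂ : Subset (suc n) → ℝ) z w → multilinear f̂ (z ∷ w) ≈
  multilinear (λ S → f̂ (outside ∷ S)) w + z * multilinear (λ S → f̂ (inside ∷ S)) w
multilinear-first {n} f̂ z w = ≈-trans
  (+-cong ≈-refl (∑⊆-cong n (λ S → termwise⇒≈ λ m →
    rotate (seq (f̂ (inside ∷ S)) m) (seq z m) (seq (monomial S w) m))))
  (≈-trans (+-cong ≈-refl (∑⊆-linear n (λ _ → 0ℝ) z (λ S → f̂ (inside ∷ S) * monomial S w)))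
    (+-cong ≈-refl (≈-trans (+-cong (∑⊆-zero n (λ _ → ≈-refl)) ≈-refl) (0+ _))))
  where
  rotate : ∀ f z p → f ℚ.* (z ℚ.* p) ≡ 0ℚ ℚ.+ z ℚ.* (f ℚ.* p)
  rotate = solve 3 (λ f z p → f :* (z :* p) := con 0ℚ :+ z :* (f :* p)) refl

multilinear-specialize : ∀ {n} (f̂ : Subset (suc n) → ℝ) z w →
  multilinear (specialize f̂ z) w ≈
  multilinear (λ S → f̂ (outside ∷ S)) w + z * multilinear (λ S → f̂ (inside ∷ S)) w
multilinear-specialize {n} f̂ z w = ≈-trans
  (∑⊆-cong n (λ S → termwise⇒≈ λ m → distribute (seq (f̂ (outside ∷ S)) m)
    (seq (f̂ (inside ∷ S)) m) (seq z m) (seq (monomial S w) m)))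
  (∑⊆-linear n (λ S → f̂ (outside ∷ S) * monomial S w) z (λ S → f̂ (inside ∷ S) * monomial S w))
  where
  distribute : ∀ f g z p → (f ℚ.+ z ℚ.* g) ℚ.* p ≡ f ℚ.* p ℚ.+ z ℚ.* (g ℚ.* p)
  distribute = solve 4 (λ f g z p → (f :+ z :* g) :* p := f :* p :+ z :* (g :* p)) refl

-- A multilinear polynomial is affine in each variable, so a lower bound on the
-- vertices of the cube holds on the whole cube.
multilinear-bound : ∀ n (f̂ : Subset n → ℝ) k →
  (∀ x → 0ℝ ≤ 1ℝ + k * multilinear f̂ (map sign x)) →
  ∀ z → All (λ t → ℚ.∣ t ∣ ℚ.≤ 1ℚ) z → 0ℝ ≤ 1ℝ + k * multilinear f̂ (map fromℚ z)
multilinear-bound zero    f̂ k h []      []           = h []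
multilinear-bound (suc n) f̂ k h (t ∷ z) (∣t∣≤1 ∷ ∣z∣≤1) = 0≤-cong
  {fromℚ (½ ℚ.* (1ℚ ℚ.- (ℚ.- t))) * (1ℝ + k * multilinear (specialize f̂ (sign plus)) (map fromℚ z)) +
   fromℚ (½ ℚ.* (1ℚ ℚ.- t)) * (1ℝ + k * multilinear (specialize f̂ (sign minus)) (map fromℚ z))}
  {1ℝ + k * multilinear f̂ (map fromℚ (t ∷ z))}
  (≈-trans
    (+-cong (*-cong ≈-refl (+-cong ≈-refl (*-cong ≈-refl
              (multilinear-specialize f̂ (sign plus) (map fromℚ z)))))
            (*-cong ≈-refl (+-cong ≈-refl (*-cong ≈-refl
              (multilinear-specialize f̂ (sign minus) (map fromℚ z))))))
    (≈-trans (termwise⇒≈ λ m → combine (seq k m) t (seq O m) (seq I m))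
      (+-cong ≈-refl (*-cong ≈-refl (≈-sym (multilinear-first f̂ (fromℚ t) (map fromℚ z)))))))
  (0≤-+ (0≤-scale (0≤* 0≤½ (0≤q-p (ℚ.≤-trans (-p≤∣p∣ t) ∣t∣≤1))) (on-face plus))
        (0≤-scale (0≤* 0≤½ (0≤q-p (ℚ.≤-trans (p≤∣p∣ t) ∣t∣≤1))) (on-face minus)))
  where
  O I : ℝ
  O = multilinear (λ S → f̂ (outside ∷ S)) (map fromℚ z)
  I = multilinear (λ S → f̂ (inside ∷ S)) (map fromℚ z)
  0≤½ : 0ℚ ℚ.≤ ½
  0≤½ = ℚ.<⇒≤ (ℚ.positive⁻¹ ½)
  on-face : ∀ σ → 0ℝ ≤ 1ℝ + k * multilinear (specialize f̂ (sign σ)) (map fromℚ z)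
  on-face σ = multilinear-bound n (specialize f̂ (sign σ)) k
    (λ x → 0≤-cong (+-cong ≈-refl (*-cong ≈-refl
      (≈-trans (multilinear-first f̂ (sign σ) (map sign x))
               (≈-sym (multilinear-specialize f̂ (sign σ) (map sign x))))))
      (h (σ ∷ x)))
    z ∣z∣≤1
  combine : ∀ k t o i →
    (½ ℚ.* (1ℚ ℚ.- (ℚ.- t))) ℚ.* (1ℚ ℚ.+ k ℚ.* (o ℚ.+ 1ℚ ℚ.* i)) ℚ.+
    (½ ℚ.* (1ℚ ℚ.- t)) ℚ.* (1ℚ ℚ.+ k ℚ.* (o ℚ.+ (ℚ.- 1ℚ) ℚ.* i)) ≡
    1ℚ ℚ.+ k ℚ.* (o ℚ.+ t ℚ.* i)
  combine = solve 4 (λ k t o i →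
    (con ½ :* (con 1ℚ :- (:- t))) :* (con 1ℚ :+ k :* (o :+ con 1ℚ :* i)) :+
    (con ½ :* (con 1ℚ :- t)) :* (con 1ℚ :+ k :* (o :+ (:- con 1ℚ) :* i)) :=
    con 1ℚ :+ k :* (o :+ t :* i)) refl

-- Restriction to the line through the origin and a vertex

power : ℚ → ℕ → ℚ
power t zero    = 1ℚ
power t (suc k) = t ℚ.* power t k

signℚ : Sign → ℚ
signℚ plus  = 1ℚ
signℚ minus = ℚ.- 1ℚ

*-interchange : ∀ t σ c p → (t ℚ.* σ) ℚ.* (c ℚ.* p) ≡ (σ ℚ.* c) ℚ.* (t ℚ.* p)
*-interchange = solve 4 (λ t σ c p → (t :* σ) :* (c :* p) := (σ :* c) :* (t :* p)) refl

-- At the point t x, the monomial of S is t^|S| χ_S(x).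
monomial-line : ∀ {n} t (S : Subset n) x →
  monomial S (map fromℚ (map (λ σ → t ℚ.* signℚ σ) x)) ≈ χ S x * fromℚ (power t ∣ S ∣)
monomial-line t []            []          = termwise⇒≈ λ _ → sym (ℚ.*-identityˡ 1ℚ)
monomial-line t (outside ∷ S) (σ ∷ x)     = monomial-line t S x
monomial-line t (inside  ∷ S) (plus ∷ x)  = ≈-trans (*-cong ≈-refl (monomial-line t S x))
  (termwise⇒≈ λ m → *-interchange t 1ℚ (seq (χ S x) m) (power t ∣ S ∣))
monomial-line t (inside  ∷ S) (minus ∷ x) = ≈-trans (*-cong ≈-refl (monomial-line t S x))
  (termwise⇒≈ λ m → *-interchange t (ℚ.- 1ℚ) (seq (χ S x) m) (power t ∣ S ∣))

-- A single term of weight w, as a coefficient sequence.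
value-single : ∀ N w g t → w ℕ.< N →
  value N (λ i → if does (w ℕ.≟ i) then g else 0ℝ) t ≈ g * fromℚ (power t w)
value-single (suc N) zero    g t _         = ≈-trans
  (+-cong ≈-refl (*-zero (fromℚ t) (value-zero N t (λ i → ≈-refl))))
  (termwise⇒≈ λ m → trans (ℚ.+-identityʳ (seq g m)) (sym (ℚ.*-identityʳ (seq g m))))
value-single (suc N) (suc w) g t (ℕ.s≤s p) = ≈-trans
  (+-cong ≈-refl (*-cong ≈-refl (value-single N w g t p)))
  (termwise⇒≈ λ m → regroup t (seq g m) (power t w))
  where
  regroup : ∀ t g p → 0ℚ ℚ.+ t ℚ.* (g ℚ.* p) ≡ g ℚ.* (t ℚ.* p)
  regroup = solve 3 (λ t g p → con 0ℚ :+ t :* (g :* p) := g :* (t :* p)) refl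

value-+ : ∀ N c c′ t → value N (λ i → c i + c′ i) t ≈ value N c t + value N c′ t
value-+ N c c′ t = ≈-trans
  (value-cong N t (λ i → +-cong (≈-refl {c i}) (≈-sym (1* (c′ i)))))
  (≈-trans (value-linear N c 1ℝ c′ t) (+-cong ≈-refl (1* (value N c′ t))))

-- Collecting the terms of equal weight.
value-collect : ∀ n N (w : Subset n → ℕ) (g : Subset n → ℝ) t → (∀ S → w S ℕ.< N) →
  value N (λ i → ∑⊆ n (λ S → if does (w S ℕ.≟ i) then g S else 0ℝ)) t ≈
  ∑⊆ n (λ S → g S * fromℚ (power t (w S)))
value-collect zero    N w g t w<N = value-single N (w []) (g []) t (w<N [])
value-collect (suc n) N w g t w<N = ≈-trans
  (value-+ N (λ i → ∑⊆ n (λ S → if does (w (outside ∷ S) ℕ.≟ i) then g (outside ∷ S) else 0ℝ))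
             (λ i → ∑⊆ n (λ S → if does (w (inside ∷ S) ℕ.≟ i) then g (inside ∷ S) else 0ℝ)) t)
  (+-cong
    (value-collect n N (λ S → w (outside ∷ S)) (λ S → g (outside ∷ S)) t (λ S → w<N (outside ∷ S)))
    (value-collect n N (λ S → w (inside ∷ S)) (λ S → g (inside ∷ S)) t (λ S → w<N (inside ∷ S))))

-- On the line through x, the homogeneous parts at x are the coefficients.
value-homogeneous : ∀ {n} (f̂ : Subset n → ℝ) x t →
  value (suc n) (λ i → homogeneousPart f̂ i x) t ≈
  multilinear f̂ (map fromℚ (map (λ σ → t ℚ.* signℚ σ) x))
value-homogeneous {n} f̂ x t = ≈-trans
  (value-collect n (suc n) ∣_∣ (λ S → f̂ S * χ S x) t (λ S → ℕ.s≤s (∣p∣≤n S)))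
  (∑⊆-cong n (λ S → ≈-sym (≈-trans (*-cong (≈-refl {f̂ S}) (monomial-line t S x))
    (termwise⇒≈ λ m → sym (ℚ.*-assoc (seq (f̂ S) m) (seq (χ S x) m) (power t ∣ S ∣))))))

if-zero : ∀ b {x} → (b ≡ true → x ≈ 0ℝ) → (if b then x else 0ℝ) ≈ 0ℝ
if-zero true  h = h refl
if-zero false h = ≈-refl

homogeneousPart-higher : ∀ {n} (f̂ : Subset n → ℝ) d x → (∀ S → d ℕ.< ∣ S ∣ → f̂ S ≈ 0ℝ) →
  ∀ i → d ℕ.< i → homogeneousPart f̂ i x ≈ 0ℝ
homogeneousPart-higher {n} f̂ d x higher i d<i = ∑⊆-zero n λ S →
  if-zero (does (∣ S ∣ ℕ.≟ i)) λ eq →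
    ≈-trans (*-cong (higher S (subst (d ℕ.<_) (sym (size S eq)) d<i)) (≈-refl {χ S x}))
            (termwise⇒≈ λ m → ℚ.*-zeroˡ (seq (χ S x) m))
  where
  size : ∀ (S : Subset n) → does (∣ S ∣ ℕ.≟ i) ≡ true → ∣ S ∣ ≡ i
  size S eq = ℕ.≡ᵇ⇒≡ ∣ S ∣ i (subst T (sym eq) tt)

-- |x| ≤ 1, as 1 + x ≥ 0 and 1 - x ≥ 0; indexing the two conditions by all
-- natural numbers j lets the signs that occur later be used directly.
Small : ℝ → Set
Small x = ∀ j → 0ℝ ≤ 1ℝ + fromℚ (sg j) * x

sg-cases : ∀ j → sg j ≡ 1ℚ ⊎ sg j ≡ ℚ.- 1ℚ
sg-cases zero    = inj₁ refl
sg-cases (suc j) = [ (λ eq → inj₂ (cong ℚ.-_ eq)) , (λ eq → inj₁ (cong ℚ.-_ eq)) ]′ (sg-cases j)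

small : ∀ {x} → - 1ℝ ≤ x → x ≤ 1ℝ → Small x
small {x} -1≤x x≤1 j = [ (λ eq → subst (λ t → 0ℝ ≤ 1ℝ + fromℚ t * x) (sym eq) above)
                       , (λ eq → subst (λ t → 0ℝ ≤ 1ℝ + fromℚ t * x) (sym eq) below′) ]′ (sg-cases j)
  where
  plus-one : ∀ x → x ℚ.- (ℚ.- 1ℚ) ≡ 1ℚ ℚ.+ 1ℚ ℚ.* x
  plus-one = solve 1 (λ x → x :- (:- con 1ℚ) := con 1ℚ :+ con 1ℚ :* x) refl
  minus-one : ∀ x → 1ℚ ℚ.- x ≡ 1ℚ ℚ.+ (ℚ.- 1ℚ) ℚ.* x
  minus-one = solve 1 (λ x → con 1ℚ :- x := con 1ℚ :+ (:- con 1ℚ) :* x) refl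
  above : 0ℝ ≤ 1ℝ + fromℚ 1ℚ * x
  above = 0≤-cong {x - (- 1ℝ)} (termwise⇒≈ λ m → plus-one (seq x m)) (0≤y-x -1≤x)
  below′ : 0ℝ ≤ 1ℝ + fromℚ (ℚ.- 1ℚ) * x
  below′ = 0≤-cong {1ℝ - x} (termwise⇒≈ λ m → minus-one (seq x m)) (0≤y-x x≤1)

small-cong : ∀ {x y} → x ≈ y → Small x → Small y
small-cong x≈y h j = 0≤-cong (+-cong ≈-refl (*-cong ≈-refl x≈y)) (h j)

-- The polynomial p(t) whose coefficients are the values of the homogeneous parts
-- at x is bounded by 1 for |t| ≤ 1.
homogeneous-small : ∀ {n} (f : Cube n → ℝ) → (∀ x → - 1ℝ ≤ f x × f x ≤ 1ℝ) →
  ∀ f̂ → IsFourierExpansion f f̂ → ∀ x t → ℚ.∣ t ∣ ℚ.≤ 1ℚ →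
  Small (value (suc n) (λ i → homogeneousPart f̂ i x) t)
homogeneous-small {n} f bound f̂ expansion x t ∣t∣≤1 =
  small-cong (≈-sym (value-homogeneous f̂ x t)) λ j →
    multilinear-bound n f̂ (fromℚ (sg j)) (λ y → vertex y j)
      (map (λ σ → t ℚ.* signℚ σ) x) (inside-cube x)
  where
  vertex : ∀ y → Small (multilinear f̂ (map sign y))
  vertex y = small-cong
    (≈-trans (expansion y) (∑⊆-cong n λ S →
      subst (λ z → f̂ S * χ S y ≈ f̂ S * z) (χ≡monomial S y) ≈-refl))
    (small (proj₁ (bound y)) (proj₂ (bound y)))
  ∣tσ∣≤1 : ∀ σ → ℚ.∣ t ℚ.* signℚ σ ∣ ℚ.≤ 1ℚ
  ∣tσ∣≤1 plus  = subst (λ p → ℚ.∣ p ∣ ℚ.≤ 1ℚ) (sym (ℚ.*-identityʳ t)) ∣t∣≤1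
  ∣tσ∣≤1 minus = subst (ℚ._≤ 1ℚ) (trans (sym (ℚ.∣-p∣≡∣p∣ t)) (cong ℚ.∣_∣ (negate t))) ∣t∣≤1
    where
    negate : ∀ t → ℚ.- t ≡ t ℚ.* (ℚ.- 1ℚ)
    negate = solve 1 (λ t → :- t := t :* (:- con 1ℚ)) refl
  inside-cube : ∀ {n} (x : Cube n) → All (λ t → ℚ.∣ t ∣ ℚ.≤ 1ℚ) (map (λ σ → t ℚ.* signℚ σ) x)
  inside-cube []      = []
  inside-cube (σ ∷ x) = ∣tσ∣≤1 σ ∷ inside-cube x

-- Coefficients of polynomials bounded on the interval

-- The part of the given parity r, as half the (anti)symmetrization.
value-part : ∀ r → r ℕ.< 2 → ∀ M c t →
  fromℚ (power t r) * value M (λ a → c (r ℕ.+ a ℕ.* 2)) (t ℚ.* t) ≈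
  fromℚ ½ * (value (M ℕ.* 2) c t + fromℚ (sg r) * value (M ℕ.* 2) c (ℚ.- t))
value-part r r<2 M c t = ≈-sym (≈-trans
  (*-cong (≈-refl {fromℚ ½}) (+-cong (value-parity M c t) (*-cong (≈-refl {fromℚ (sg r)}) at-minus)))
  (select r r<2))
  where
  even odd : ℚ → ℝ
  even u = value M (λ a → c (a ℕ.* 2)) u
  odd  u = value M (λ a → c (suc (a ℕ.* 2))) u
  at-minus : value (M ℕ.* 2) c (ℚ.- t) ≈
             even (t ℚ.* t) + fromℚ (ℚ.- t) * odd (t ℚ.* t)
  at-minus = subst (λ u → value (M ℕ.* 2) c (ℚ.- t) ≈ even u + fromℚ (ℚ.- t) * odd u)
    (neg*neg t) (value-parity M c (ℚ.- t))
  select : ∀ r → r ℕ.< 2 →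
    fromℚ ½ * ((even (t ℚ.* t) + fromℚ t * odd (t ℚ.* t)) +
               fromℚ (sg r) * (even (t ℚ.* t) + fromℚ (ℚ.- t) * odd (t ℚ.* t))) ≈
    fromℚ (power t r) * value M (λ a → c (r ℕ.+ a ℕ.* 2)) (t ℚ.* t)
  select 0 _ = termwise⇒≈ λ m → sum t (seq (even (t ℚ.* t)) m) (seq (odd (t ℚ.* t)) m)
    where
    sum : ∀ t u v → ½ ℚ.* ((u ℚ.+ t ℚ.* v) ℚ.+ 1ℚ ℚ.* (u ℚ.+ (ℚ.- t) ℚ.* v)) ≡ 1ℚ ℚ.* u
    sum = solve 3 (λ t u v → con ½ :* ((u :+ t :* v) :+ con 1ℚ :* (u :+ (:- t) :* v)) :=
                             con 1ℚ :* u) refl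
  select 1 _ = termwise⇒≈ λ m → difference t (seq (even (t ℚ.* t)) m) (seq (odd (t ℚ.* t)) m)
    where
    difference : ∀ t u v → ½ ℚ.* ((u ℚ.+ t ℚ.* v) ℚ.+ (ℚ.- 1ℚ) ℚ.* (u ℚ.+ (ℚ.- t) ℚ.* v)) ≡
                           (t ℚ.* 1ℚ) ℚ.* v
    difference = solve 3 (λ t u v →
      con ½ :* ((u :+ t :* v) :+ (:- con 1ℚ) :* (u :+ (:- t) :* v)) := (t :* con 1ℚ) :* v) refl
  select (suc (suc _)) (ℕ.s≤s (ℕ.s≤s ()))

power-positive : ∀ {t} → 0ℚ ℚ.< t → ∀ k → 0ℚ ℚ.< power t k
power-positive 0<t zero    = 0<1
power-positive 0<t (suc k) = 0<* 0<t (power-positive 0<t k)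

sg*sg : ∀ k → sg k ℚ.* sg k ≡ 1ℚ
sg*sg zero    = refl
sg*sg (suc k) = trans (neg*neg (sg k)) (sg*sg k)

sg-parity : ∀ r m → sg (r ℕ.+ m ℕ.* 2) ≡ sg r
sg-parity r zero    = cong sg (ℕ.+-identityʳ r)
sg-parity r (suc m) = trans (cong sg (index r m))
  (trans (neg-involutive (sg (r ℕ.+ m ℕ.* 2))) (sg-parity r m))
  where
  index : ∀ r m → r ℕ.+ suc m ℕ.* 2 ≡ suc (suc (r ℕ.+ m ℕ.* 2))
  index = ℕ-solve 2 (λ r m → r ⊞ (ℕ-con 1 ⊞ m) ⊛ ℕ-con 2 ≔ ℕ-con 2 ⊞ (r ⊞ m ⊛ ℕ-con 2)) refl

-- The Chebyshev polynomial at the cosine of a rational angle; the equation defining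
-- it also holds at the opposite angle, which gives the value at - c.
module _ {e : ℕ} {p : Poly} (chebyshev : IsChebyshev e p)
         (c s : ℚ) (unit : OnCircle c s) (N : ℕ) (e<N : e ℕ.< N) where

  chebyshev-value : value N (coeff p) c ≈ fromℚ (cosine c s e)
  chebyshev-value = ≈-trans
    (≈-sym (eval-value N p c (λ i N≤i → IsChebyshev.higher chebyshev i (ℕ.<-≤-trans e<N N≤i))))
    (≈-trans (IsChebyshev.cosine chebyshev (rational-angle c s unit))
             (termwise⇒≈ (cos-multiple c s unit e)))

chebyshev-value-neg : ∀ {e p} → IsChebyshev e p → ∀ c s → OnCircle c s → ∀ N → e ℕ.< N →
  value N (coeff p) (ℚ.- c) ≈ fromℚ (sg e ℚ.* cosine c s e)
chebyshev-value-neg {e} chebyshev c s unit N e<N = ≈-trans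
  (chebyshev-value chebyshev (ℚ.- c) (ℚ.- s) (onCircle-neg c s unit) N e<N)
  (termwise⇒≈ λ _ → cosine-neg c s e)

-- The sign at one of the points.  Here τ are the coefficients of the Chebyshev
-- polynomial T, with value X at t, and c those of a polynomial p bounded by 1 at t
-- and - t; q are the coefficients, in the variable t², of the part of parity r of
-- T + κ p with κ = (-1)^j (1 - δ).
module AtNode (r : ℕ) (r<2 : r ℕ.< 2) (M : ℕ) (c τ : ℕ → ℝ) (t X δ : ℚ) (k j : ℕ)
  (X-value : value (M ℕ.* 2) τ t ≈ fromℚ X)
  (X-value-neg : value (M ℕ.* 2) τ (ℚ.- t) ≈ fromℚ (sg r ℚ.* X))
  (p-small : Small (value (M ℕ.* 2) c t))
  (p-small-neg : Small (value (M ℕ.* 2) c (ℚ.- t)))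
  (X-extremal : 1ℚ ℚ.- δ ℚ.≤ sg k ℚ.* X) (0≤1-δ : 0ℚ ℚ.≤ 1ℚ ℚ.- δ) where

  q : ℕ → ℝ
  q a = τ (r ℕ.+ a ℕ.* 2) + fromℚ (sg j ℚ.* (1ℚ ℚ.- δ)) * c (r ℕ.+ a ℕ.* 2)

  P⁺ P⁻ : ℝ
  P⁺ = value (M ℕ.* 2) c t
  P⁻ = value (M ℕ.* 2) c (ℚ.- t)

  T-part : fromℚ (power t r) * value M (λ a → τ (r ℕ.+ a ℕ.* 2)) (t ℚ.* t) ≈ fromℚ X
  T-part = ≈-trans (value-part r r<2 M τ t)
    (≈-trans (*-cong (≈-refl {fromℚ ½}) (+-cong X-value (*-cong (≈-refl {fromℚ (sg r)}) X-value-neg)))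
      (termwise⇒≈ λ _ → trans (regroup (sg r) X)
        (subst (λ z → ½ ℚ.* (X ℚ.+ z ℚ.* X) ≡ X) (sym (sg*sg r)) (double X))))
    where
    regroup : ∀ σ X → ½ ℚ.* (X ℚ.+ σ ℚ.* (σ ℚ.* X)) ≡ ½ ℚ.* (X ℚ.+ (σ ℚ.* σ) ℚ.* X)
    regroup = solve 2 (λ σ X → con ½ :* (X :+ σ :* (σ :* X)) :=
                               con ½ :* (X :+ (σ :* σ) :* X)) refl
    double : ∀ X → ½ ℚ.* (X ℚ.+ 1ℚ ℚ.* X) ≡ X
    double = solve 1 (λ X → con ½ :* (X :+ con 1ℚ :* X) := X) refl

  q-part : fromℚ (power t r) * value M q (t ℚ.* t) ≈
           fromℚ X + fromℚ (sg j ℚ.* (1ℚ ℚ.- δ)) * (fromℚ ½ * (P⁺ + fromℚ (sg r) * P⁻))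
  q-part = begin
    fromℚ (power t r) * value M q (t ℚ.* t)
      ≈⟨ *-cong (≈-refl {fromℚ (power t r)}) (value-linear M (λ a → τ (r ℕ.+ a ℕ.* 2))
           (fromℚ κ) (λ a → c (r ℕ.+ a ℕ.* 2)) (t ℚ.* t)) ⟩
    fromℚ (power t r) * (Vτ + fromℚ κ * Vc)
      ≈⟨ termwise⇒≈ (λ m → regroup (power t r) (seq Vτ m) κ (seq Vc m)) ⟩
    fromℚ (power t r) * Vτ + fromℚ κ * (fromℚ (power t r) * Vc)
      ≈⟨ +-cong T-part (*-cong (≈-refl {fromℚ κ}) (value-part r r<2 M c t)) ⟩
    fromℚ X + fromℚ κ * (fromℚ ½ * (P⁺ + fromℚ (sg r) * P⁻)) ∎
    where
    κ : ℚ
    κ = sg j ℚ.* (1ℚ ℚ.- δ)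
    Vτ Vc : ℝ
    Vτ = value M (λ a → τ (r ℕ.+ a ℕ.* 2)) (t ℚ.* t)
    Vc = value M (λ a → c (r ℕ.+ a ℕ.* 2)) (t ℚ.* t)
    regroup : ∀ p v κ w → p ℚ.* (v ℚ.+ κ ℚ.* w) ≡ p ℚ.* v ℚ.+ κ ℚ.* (p ℚ.* w)
    regroup = solve 4 (λ p v κ w → p :* (v :+ κ :* w) := p :* v :+ κ :* (p :* w)) refl

  -- (-1)^k X - (1 - δ) is nonnegative, and so is the remaining
  -- (1 - δ) (1 ± (half of P⁺ ± P⁻)) because P⁺ and P⁻ are bounded by 1.
  signed : 0ℝ ≤ fromℚ (1ℚ ℚ.* sg k) *
                (fromℚ X + fromℚ (sg j ℚ.* (1ℚ ℚ.- δ)) * (fromℚ ½ * (P⁺ + fromℚ (sg r) * P⁻)))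
  signed = 0≤-cong (termwise⇒≈ λ m → trans
      (cong₂ (λ σ ρ → ((sg k ℚ.* X) ℚ.- (1ℚ ℚ.- δ)) ℚ.+ (1ℚ ℚ.- δ) ℚ.*
          (½ ℚ.* (1ℚ ℚ.+ σ ℚ.* seq P⁺ m) ℚ.+ ½ ℚ.* (1ℚ ℚ.+ ρ ℚ.* seq P⁻ m)))
        (sg-+ k j) (trans (sg-+ (k ℕ.+ j) r) (cong (ℚ._* sg r) (sg-+ k j))))
      (combine (sg k) (sg j) (sg r) X (1ℚ ℚ.- δ) (seq P⁺ m) (seq P⁻ m)))
    (0≤-+ {fromℚ ((sg k ℚ.* X) ℚ.- (1ℚ ℚ.- δ))}
          {fromℚ (1ℚ ℚ.- δ) * (fromℚ ½ * (1ℝ + fromℚ (sg (k ℕ.+ j)) * P⁺) +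
                               fromℚ ½ * (1ℝ + fromℚ (sg (k ℕ.+ j ℕ.+ r)) * P⁻))}
      (fromℚ-mono (0≤q-p X-extremal))
      (0≤-scale 0≤1-δ (0≤-+ (0≤-scale 0≤½ (p-small (k ℕ.+ j)))
                            (0≤-scale 0≤½ (p-small-neg (k ℕ.+ j ℕ.+ r))))))
    where
    0≤½ : 0ℚ ℚ.≤ ½
    0≤½ = ℚ.<⇒≤ (ℚ.positive⁻¹ ½)
    combine : ∀ σ τ ρ X d x y →
      ((σ ℚ.* X) ℚ.- d) ℚ.+ d ℚ.* (½ ℚ.* (1ℚ ℚ.+ (σ ℚ.* τ) ℚ.* x) ℚ.+
                                   ½ ℚ.* (1ℚ ℚ.+ ((σ ℚ.* τ) ℚ.* ρ) ℚ.* y)) ≡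
      (1ℚ ℚ.* σ) ℚ.* (X ℚ.+ (τ ℚ.* d) ℚ.* (½ ℚ.* (x ℚ.+ ρ ℚ.* y)))
    combine = solve 7 (λ σ τ ρ X d x y →
      ((σ :* X) :- d) :+ d :* (con ½ :* (con 1ℚ :+ (σ :* τ) :* x) :+
                               con ½ :* (con 1ℚ :+ ((σ :* τ) :* ρ) :* y)) :=
      (con 1ℚ :* σ) :* (X :+ (τ :* d) :* (con ½ :* (x :+ ρ :* y)))) refl

  node-sign : 0ℚ ℚ.< t → 0ℝ ≤ fromℚ (1ℚ ℚ.* sg k) * value M q (t ℚ.* t)
  node-sign 0<t = 0≤-unscale (power-positive 0<t r)
    (0≤-cong (≈-sym (≈-trans
        (termwise⇒≈ λ m → swap (power t r) (1ℚ ℚ.* sg k) (seq (value M q (t ℚ.* t)) m))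
        (*-cong (≈-refl {fromℚ (1ℚ ℚ.* sg k)}) q-part)))
      signed)
    where
    swap : ∀ p σ v → p ℚ.* (σ ℚ.* v) ≡ σ ℚ.* (p ℚ.* v)
    swap = solve 3 (λ p σ v → p :* (σ :* v) := σ :* (p :* v)) refl

-- V. A. Markov's bound: if p is a Chebyshev polynomial of degree e, then it has the
-- largest coefficients in absolute value, at indices of the parity of e, among the
-- polynomials of degree at most e + 1 bounded by 1 on the interval.  The bounded
-- polynomial is given by its coefficients c, and every sufficiently long truncation
-- represents it.
module MarkovBound {e : ℕ} {p : Poly} (chebyshev : IsChebyshev e p)
  (c : ℕ → ℝ) (c-higher : ∀ i → suc e ℕ.< i → c i ≈ 0ℝ)
  (c-small : ∀ N → suc e ℕ.< N → ∀ t → ℚ.∣ t ∣ ℚ.≤ 1ℚ → Small (value N c t))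
  (r m b : ℕ) (r<2 : r ℕ.< 2) (e≡ : e ≡ r ℕ.+ m ℕ.* 2) (b≤m : b ℕ.≤ m) where

  2m≤e : m ℕ.* 2 ℕ.≤ e
  2m≤e = ℕ.≤-trans (ℕ.m≤n+m (m ℕ.* 2) r) (ℕ.≤-reflexive (sym e≡))

  1+e<M*2 : suc e ℕ.< suc (suc m) ℕ.* 2
  1+e<M*2 = ℕ.≤-trans (ℕ.≤-reflexive (cong (λ e → suc (suc e)) e≡))
    (ℕ.s≤s (ℕ.s≤s (ℕ.+-monoˡ-≤ (m ℕ.* 2) (ℕ.<⇒≤ r<2))))

  -- The part of parity r has degree at most m in t², although its values at the
  -- points are computed with one more coefficient.
  top-index : suc e ℕ.< r ℕ.+ suc m ℕ.* 2
  top-index = ℕ.≤-reflexive (trans (cong (λ e → suc (suc e)) e≡) (index r m))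
    where
    index : ∀ r m → suc (suc (r ℕ.+ m ℕ.* 2)) ≡ r ℕ.+ suc m ℕ.* 2
    index = ℕ-solve 2 (λ r m → ℕ-con 2 ⊞ (r ⊞ m ⊛ ℕ-con 2) ≔ r ⊞ (ℕ-con 1 ⊞ m) ⊛ ℕ-con 2) refl

  ℓ : ℕ
  ℓ = r ℕ.+ b ℕ.* 2

  module _ (δ : ℚ) (0<δ : 0ℚ ℚ.< δ) (δ≤1 : δ ℚ.≤ 1ℚ) (j : ℕ) where

    open Extrema (extrema-exist e m δ 2m≤e 0<δ δ≤1) renaming (c to γ; s to σ)

    node : ℕ → ℚ
    node = cosine γ σ

    ∣node∣≤1 : ∀ k → ℚ.∣ node k ∣ ℚ.≤ 1ℚ
    ∣node∣≤1 k = ∣cos∣≤1 (node k) (sine γ σ k) (onCircle-multiple γ σ unit k)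

    q : ℕ → ℝ
    q a = coeff p (r ℕ.+ a ℕ.* 2) + fromℚ (sg j ℚ.* (1ℚ ℚ.- δ)) * c (r ℕ.+ a ℕ.* 2)

    q-top : q (suc m) ≈ 0ℝ
    q-top = ≈-trans
      (+-cong (IsChebyshev.higher chebyshev (r ℕ.+ suc m ℕ.* 2) (ℕ.<⇒≤ top-index))
              (*-zero (fromℚ (sg j ℚ.* (1ℚ ℚ.- δ))) (c-higher (r ℕ.+ suc m ℕ.* 2) top-index)))
      (0+ 0ℝ)

    alternates : ∀ k → k ℕ.≤ m →
      0ℝ ≤ fromℚ (1ℚ ℚ.* sg k) * value (suc m) q (node k ℚ.* node k)
    alternates k k≤m = 0≤-scale-cong (1ℚ ℚ.* sg k)
      (value (suc (suc m)) q (node k ℚ.* node k)) (value (suc m) q (node k ℚ.* node k))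
      (value-snoc (suc m) {q} (node k ℚ.* node k) q-top)
      (AtNode.node-sign r r<2 (suc (suc m)) c (coeff p) (node k) (cosine γ σ (e ℕ.* k)) δ k j
        (≈-trans (chebyshev-value chebyshev (node k) (sine γ σ k)
                   (onCircle-multiple γ σ unit k) (suc (suc m) ℕ.* 2) (ℕ.<⇒≤ 1+e<M*2))
                 (termwise⇒≈ λ _ → cosine-* γ σ k e))
        (≈-trans (chebyshev-value-neg chebyshev (node k) (sine γ σ k)
                   (onCircle-multiple γ σ unit k) (suc (suc m) ℕ.* 2) (ℕ.<⇒≤ 1+e<M*2))
                 (termwise⇒≈ λ _ → cong₂ ℚ._*_ (trans (cong sg e≡) (sg-parity r m))
                                               (cosine-* γ σ k e)))
        (c-small (suc (suc m) ℕ.* 2) 1+e<M*2 (node k) (∣node∣≤1 k))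
        (c-small (suc (suc m) ℕ.* 2) 1+e<M*2 (ℚ.- node k)
          (subst (ℚ._≤ 1ℚ) (sym (ℚ.∣-p∣≡∣p∣ (node k))) (∣node∣≤1 k)))
        (alternating k k≤m) (0≤q-p δ≤1) (positive k k≤m))

    squares-decrease : ∀ k → k ℕ.< m →
      node (suc k) ℚ.* node (suc k) ℚ.< node k ℚ.* node k
    squares-decrease k k<m = 0<q-p⁻¹ (subst (0ℚ ℚ.<_) (factor (node k) (node (suc k)))
      (0<* (0<q-p (decreasing k k<m))
           (0<+0≤ (positive k (ℕ.<⇒≤ k<m)) (ℚ.<⇒≤ (positive (suc k) k<m)))))
      where
      factor : ∀ x y → (x ℚ.- y) ℚ.* (x ℚ.+ y) ≡ x ℚ.* x ℚ.- y ℚ.* y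
      factor = solve 2 (λ x y → (x :- y) :* (x :+ y) := x :* x :- y :* y) refl

    coefficient-sign : 0ℝ ≤ fromℚ (1ℚ ℚ.* sg (m ℕ.+ b)) * q b
    coefficient-sign = alternating-coefficients m 1ℚ (λ k → node k ℚ.* node k)
      (λ k k≤m → 0<* (positive k k≤m) (positive k k≤m)) squares-decrease q alternates b b≤m

  -- The index j = m + b + i in coefficient-sign turns the sign of c ℓ, multiplied
  -- by (-1)^(m+b), into (-1)^i.
  one-sided : ∀ i → fromℚ (sg (suc i)) * c ℓ ≤ abs (coeff p ℓ)
  one-sided i = ≤-limit λ δ 0<δ δ≤1 → ≤-trans
    (0≤y-x⁻¹ (0≤-cong
      {fromℚ (1ℚ ℚ.* sg (m ℕ.+ b)) *
        (coeff p ℓ + fromℚ (sg (m ℕ.+ b ℕ.+ i) ℚ.* (1ℚ ℚ.- δ)) * c ℓ)}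
      {fromℚ (sg (m ℕ.+ b)) * coeff p ℓ - fromℚ (1ℚ ℚ.- δ) * (fromℚ (sg (suc i)) * c ℓ)}
      (termwise⇒≈ λ n → trans
        (trans (cong (λ z → (1ℚ ℚ.* sg (m ℕ.+ b)) ℚ.* (seq (coeff p ℓ) n ℚ.+ (z ℚ.* (1ℚ ℚ.- δ)) ℚ.* seq (c ℓ) n))
                 (sg-+ (m ℕ.+ b) i))
               (expand (sg (m ℕ.+ b)) (sg i) (1ℚ ℚ.- δ) (seq (coeff p ℓ) n) (seq (c ℓ) n)))
        (trans (cong (λ z → sg (m ℕ.+ b) ℚ.* seq (coeff p ℓ) n ℚ.+ z ℚ.* (sg i ℚ.* ((1ℚ ℚ.- δ) ℚ.* seq (c ℓ) n)))
                 (sg*sg (m ℕ.+ b)))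
               (collect (sg (m ℕ.+ b) ℚ.* seq (coeff p ℓ) n) (sg i) (1ℚ ℚ.- δ) (seq (c ℓ) n))))
      (coefficient-sign δ 0<δ δ≤1 (m ℕ.+ b ℕ.+ i))))
    (termwise⇒≤ λ n → subst (sg (m ℕ.+ b) ℚ.* seq (coeff p ℓ) n ℚ.≤_)
      (∣sg*p∣ (m ℕ.+ b) (seq (coeff p ℓ) n)) (p≤∣p∣ (sg (m ℕ.+ b) ℚ.* seq (coeff p ℓ) n)))
    where
    expand : ∀ σ τ d x y → (1ℚ ℚ.* σ) ℚ.* (x ℚ.+ ((σ ℚ.* τ) ℚ.* d) ℚ.* y) ≡
                           σ ℚ.* x ℚ.+ (σ ℚ.* σ) ℚ.* (τ ℚ.* (d ℚ.* y))
    expand = solve 5 (λ σ τ d x y → (con 1ℚ :* σ) :* (x :+ ((σ :* τ) :* d) :* y) :=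
                                    σ :* x :+ (σ :* σ) :* (τ :* (d :* y))) refl
    collect : ∀ x τ d y → x ℚ.+ 1ℚ ℚ.* (τ ℚ.* (d ℚ.* y)) ≡ x ℚ.- d ℚ.* ((ℚ.- τ) ℚ.* y)
    collect = solve 4 (λ x τ d y → x :+ con 1ℚ :* (τ :* (d :* y)) :=
                                   x :- d :* ((:- τ) :* y)) refl

  coefficient-bound : abs (c ℓ) ≤ abs (coeff p ℓ)
  coefficient-bound = ∣x∣≤
    (≤-trans (≤-reflexive (termwise⇒≈ λ n → sym (ℚ.*-identityˡ (seq (c ℓ) n)))) (one-sided 1))
    (≤-trans (≤-reflexive (termwise⇒≈ λ n → negate (seq (c ℓ) n))) (one-sided 0))
    where
    negate : ∀ x → ℚ.- x ≡ (ℚ.- 1ℚ) ℚ.* x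
    negate = solve 1 (λ x → :- x := (:- con 1ℚ) :* x) refl

-- Bounded functions on the cube

maxCube-lub : ∀ n {g : Cube n → ℝ} {z} → (∀ x → g x ≤ z) → maxCube n g ≤ z
maxCube-lub zero    h = h []
maxCube-lub (suc n) h = ⊔-lub (maxCube-lub n (λ x → h (plus ∷ x)))
                              (maxCube-lub n (λ x → h (minus ∷ x)))

homogeneousPart-bound : ∀ {n} (f : Cube n → ℝ) → (∀ x → - 1ℝ ≤ f x × f x ≤ 1ℝ) →
  ∀ f̂ → IsFourierExpansion f f̂ → ∀ e {p} → IsChebyshev e p →
  (∀ S → suc e ℕ.< ∣ S ∣ → f̂ S ≈ 0ℝ) →
  ∀ ℓ → ℓ ℕ.≤ e → e % 2 ≡ ℓ % 2 → ‖ homogeneousPart f̂ ℓ ‖∞ ≤ abs (coeff p ℓ)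
homogeneousPart-bound {n} f bound f̂ expansion e {p} chebyshev higher ℓ ℓ≤e same-parity =
  maxCube-lub n λ x →
    subst (λ i → abs (homogeneousPart f̂ i x) ≤ abs (coeff p i)) (sym ℓ≡)
      (MarkovBound.coefficient-bound chebyshev (λ i → homogeneousPart f̂ i x)
        (vanish x) (c-small x) (e % 2) (e ℕ./ 2) (ℓ ℕ./ 2)
        (ℕ.m%n<n e 2) (ℕ.m≡m%n+[m/n]*n e 2) (ℕ./-monoˡ-≤ 2 ℓ≤e))
  where
  ℓ≡ : ℓ ≡ e % 2 ℕ.+ ℓ ℕ./ 2 ℕ.* 2
  ℓ≡ = trans (ℕ.m≡m%n+[m/n]*n ℓ 2) (cong (ℕ._+ ℓ ℕ./ 2 ℕ.* 2) (sym same-parity))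
  vanish : ∀ x i → suc e ℕ.< i → homogeneousPart f̂ i x ≈ 0ℝ
  vanish x = homogeneousPart-higher f̂ (suc e) x higher
  -- Truncation at N and at n + 1 gives the same polynomial: all coefficients
  -- beyond the smaller of the two vanish.
  c-small : ∀ x N → suc e ℕ.< N → ∀ t → ℚ.∣ t ∣ ℚ.≤ 1ℚ →
            Small (value N (λ i → homogeneousPart f̂ i x) t)
  c-small x N e<N t ∣t∣≤1 = small-cong
    (≈-trans
      (≈-sym (value-extend t (ℕ.m≤m⊔n (suc n) N) (homogeneousPart-higher f̂ n x
        (λ S n<∣S∣ → ⊥-elim (ℕ.<⇒≱ n<∣S∣ (∣p∣≤n S))))))
      (value-extend t (ℕ.m≤n⊔m (suc n) N) (λ i N≤i → vanish x i (ℕ.<-≤-trans e<N N≤i))))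
    (homogeneous-small f bound f̂ expansion x t ∣t∣≤1)

opposite-parity : ∀ d ℓ → suc d % 2 ≢ ℓ % 2 → d % 2 ≡ ℓ % 2
opposite-parity zero          zero          _   = refl
opposite-parity zero          (suc zero)    neq = ⊥-elim (neq refl)
opposite-parity (suc zero)    zero          neq = ⊥-elim (neq refl)
opposite-parity (suc zero)    (suc zero)    _   = refl
opposite-parity (suc (suc d)) ℓ             neq = opposite-parity d ℓ neq
opposite-parity d             (suc (suc ℓ)) neq = opposite-parity d ℓ neq

theorem1 : (T : ℕ → Poly) → (∀ k → IsChebyshev k (T k)) →
    ∀ (n : ℕ) → 1 ℕ.≤ n →
    (f : Cube n → ℝ) → (∀ x → - 1ℝ ≤ f x × f x ≤ 1ℝ) →
    (f̂ : Subset n → ℝ) → IsFourierExpansion f f̂ →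
    ∀ (d : ℕ) → HasDegree f̂ d →
    ∀ (ℓ : ℕ) → ℓ ℕ.≤ d →
    (d % 2 ≡ ℓ % 2 → ‖ homogeneousPart f̂ ℓ ‖∞ ≤ abs (coeff (T d) ℓ)) ×
    (d % 2 ≢ ℓ % 2 → ‖ homogeneousPart f̂ ℓ ‖∞ ≤ abs (coeff (T (d ∸ 1)) ℓ))
theorem1 T chebyshev n _ f bound f̂ expansion d (higher , _) ℓ ℓ≤d =
  (λ same → homogeneousPart-bound f bound f̂ expansion d (chebyshev d)
     (λ S 1+d<∣S∣ → higher S (ℕ.<⇒≤ 1+d<∣S∣)) ℓ ℓ≤d same) ,
  other d ℓ≤d higher
  where
  other : ∀ d → ℓ ℕ.≤ d → (∀ S → d ℕ.< ∣ S ∣ → f̂ S ≈ 0ℝ) →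
          d % 2 ≢ ℓ % 2 → ‖ homogeneousPart f̂ ℓ ‖∞ ≤ abs (coeff (T (d ∸ 1)) ℓ)
  other zero    ℓ≤0   _      neq = ⊥-elim (neq (cong (_% 2) (sym (ℕ.n≤0⇒n≡0 ℓ≤0))))
  other (suc e) ℓ≤1+e higher neq =
    homogeneousPart-bound f bound f̂ expansion e (chebyshev e) higher ℓ
      (ℕ.s≤s⁻¹ (ℕ.≤∧≢⇒< ℓ≤1+e λ ℓ≡1+e → neq (cong (_% 2) (sym ℓ≡1+e))))
      (opposite-parity e ℓ neq)
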